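{- For every fixed integer $k\geq 0$, the problem \textsc{$k$-Reversals} can be solved in polynomial time. Here \textsc{$k$-Reversals} is: given a digraph $D=(V,A)$ with diameter $d_D$ and an integer $d$ with $2 \leq d < d_D$, decide whether a digraph of diameter at most $d$ can be obtained from $D$ by performing at most $k$ arc reversals.
   Context: For a digraph, the distance from $u$ to $v$ is the length (number of arcs) of a shortest directed path from $u$ to $v$, and is $\infty$ if no such path exists. The diameter of a digraph is the maximum distance over all ordered pairs of vertices. An arc reversal of an arc $(u,v)$ in a digraph $(V,A)$ produces the digraph $(V,(A\setminus\{(u,v)\})\cup\{(v,u)\})$. -}

module Defs where

open import Data.Bool using (Bool; true; false; T; _∧_; _∨_; not)
open import Data.Digit using (Bit; toDigits)
open import Data.Fin using (Fin; zero; suc; _≟_)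
open import Data.List using (List; []; _∷_; _++_; map; concatMap; tabulate; allFin; length)
open import Data.List.Relation.Unary.Unique.Propositional using (Unique)
open import Data.Nat using (ℕ; zero; suc; _+_; _*_; _^_; _≤_; _<_)
open import Data.Product using (_×_; _,_; proj₁; ∃-syntax; Σ-syntax)
open import Data.Sum using (_⊎_)
open import Data.Vec using (Vec; _∷_; replicate; zipWith) renaming (map to mapᵛ)
open import Relation.Binary.Construct.Add.Supremum.NonStrict _≤_ using (_≤⁺_)
open import Relation.Binary.Construct.Add.Supremum.Strict _<_ using (_<⁺_)
open import Relation.Binary.Construct.Closure.ReflexiveTransitive using (Star; ε; _◅_)
open import Relation.Binary.PropositionalEquality using (_≡_)
open import Relation.Nullary using (¬_; does)
open import Relation.Nullary.Construct.Add.Supremum using (_⁺; [_]; ⊤⁺)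

-- The arc set of a digraph on the vertex set Fin n, as a characteristic
-- function.
Digraph : ℕ → Set
Digraph n = Fin n → Fin n → Bool

module _ {n : ℕ} where

  Arc : Digraph n → Fin n → Fin n → Set
  Arc D u v = T (D u v)

  Walk : Digraph n → Fin n → Fin n → Set
  Walk D = Star (Arc D)

  walkLength : ∀ {R : Fin n → Fin n → Set} {u v} → Star R u v → ℕ
  walkLength ε       = 0
  walkLength (_ ◅ w) = suc (walkLength w)

  vertices : ∀ {R : Fin n → Fin n → Set} {u v} → Star R u v → List (Fin n)
  vertices {u = u} ε       = u ∷ []
  vertices {u = u} (_ ◅ w) = u ∷ vertices w

  record Path (D : Digraph n) (u v : Fin n) : Set where
    field
      walk   : Walk D u v
      simple : Unique (vertices walk)

  pathLength : ∀ {D : Digraph n} {u v} → Path D u v → ℕ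
  pathLength p = walkLength (Path.walk p)

  -- ℕ ⁺ is ℕ ∪ {∞}, with ⊤⁺ as ∞.
  data Distance (D : Digraph n) (u v : Fin n) : ℕ ⁺ → Set where
    finite   : (p : Path D u v) → ((q : Path D u v) → pathLength p ≤ pathLength q) →
               Distance D u v [ pathLength p ]
    infinite : ¬ Path D u v → Distance D u v ⊤⁺

  -- The maximum must be attained, so the digraph without vertices has no
  -- diameter.
  Diameter : Digraph n → ℕ ⁺ → Set
  Diameter D m =
    (∃[ u ] ∃[ v ] Distance D u v m) ×
    (∀ u v {l} → Distance D u v l → l ≤⁺ m)

  -- (A ∖ {(u,v)}) ∪ {(v,u)}
  reverseArc : Digraph n → Fin n → Fin n → Digraph n
  reverseArc D u v x y =
    (D x y ∧ not (does (x ≟ u) ∧ does (y ≟ v))) ∨ (does (x ≟ v) ∧ does (y ≟ u))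

  -- At most k arc reversals, performed one after another.
  data Reversible : ℕ → Digraph n → Digraph n → Set where
    done : ∀ {k D} → Reversible k D D
    step : ∀ {k D D′} u v → Arc D u v →
           Reversible k (reverseArc D u v) D′ → Reversible (suc k) D D′

data Symbol : Set where
  bit : Bool → Symbol
  #   : Symbol

data Cell (g : ℕ) : Set where
  blank : Cell g
  input : Symbol → Cell g
  work  : Fin g → Cell g

data Control (q : ℕ) : Set where
  running       : Fin q → Control q
  accept reject : Control q

data Move : Set where
  left stay right : Move

record TuringMachine : Set where
  field
    extraTapes  : ℕ
    workSymbols : ℕ
    states      : ℕ
    start       : Control states
    δ           : Fin states → Vec (Cell workSymbols) (suc extraTapes) →
                  Control states × Vec (Cell workSymbols × Move) (suc extraTapes)

-- A two-way infinite tape.  Both lists are ordered outwards from the head,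
-- and every cell beyond them is blank.
record Tape (g : ℕ) : Set where
  constructor tape
  field
    before : List (Cell g)
    head   : Cell g
    after  : List (Cell g)

module _ {g : ℕ} where

  move : Move → Tape g → Tape g
  move left  (tape []       c rs)       = tape [] blank (c ∷ rs)
  move left  (tape (l ∷ ls) c rs)       = tape ls l (c ∷ rs)
  move stay  t                          = t
  move right (tape ls       c [])       = tape (c ∷ ls) blank []
  move right (tape ls       c (r ∷ rs)) = tape (c ∷ ls) r rs

  act : Cell g × Move → Tape g → Tape g
  act (c , m) (tape ls _ rs) = move m (tape ls c rs)

  blankTape : Tape g
  blankTape = tape [] blank []

  inputTape : List Symbol → Tape g
  inputTape []      = blankTape
  inputTape (a ∷ w) = tape [] (input a) (map input w)

module _ (M : TuringMachine) where
  open TuringMachine M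

  record Config : Set where
    constructor config
    field
      control : Control states
      tapes   : Vec (Tape workSymbols) (suc extraTapes)

  initial : List Symbol → Config
  initial w = config start (inputTape w ∷ replicate extraTapes blankTape)

  next : Config → Config
  next (config (running q) ts) =
    let (s , actions) = δ q (mapᵛ Tape.head ts)
    in  config s (zipWith act actions ts)
  next c@(config accept _) = c
  next c@(config reject _) = c

  run : ℕ → Config → Config
  run zero    c = c
  run (suc t) c = run t (next c)

  outcome : ℕ → List Symbol → Control states
  outcome t w = Config.control (run t (initial w))

record DecisionProblem : Set₁ where
  field
    Instance : Set
    Yes      : Instance → Set
    encode   : Instance → List Symbol

PolynomialTime : DecisionProblem → Set
PolynomialTime P =
  Σ[ M ∈ TuringMachine ] ∃[ c ] ∃[ e ] ∀ x →
    ∃[ t ] t ≤ c * length (encode x) ^ e + c ×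
           ((Yes x × outcome M t (encode x) ≡ accept) ⊎
            (¬ Yes x × outcome M t (encode x) ≡ reject))
  where open DecisionProblem P

record ReversalsInstance : Set where
  field
    order      : ℕ
    digraph    : Digraph order
    diameter   : ℕ ⁺
    isDiameter : Diameter digraph diameter
    target     : ℕ
    2≤target   : 2 ≤ target
    target<    : [ target ] <⁺ diameter

encodeBit : Bit → Symbol
encodeBit zero    = bit false
encodeBit (suc _) = bit true

-- The target in binary (least significant bit first), then the rows of the
-- adjacency matrix; each of these blocks is terminated by #.
encodeInstance : ReversalsInstance → List Symbol
encodeInstance I =
  map encodeBit (proj₁ (toDigits 2 target)) ++ # ∷
  concatMap (λ u → tabulate (λ v → bit (digraph u v)) ++ # ∷ []) (allFin order)
  where open ReversalsInstance I

k-Reversals : ℕ → DecisionProblem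
k-Reversals k = record
  { Instance = ReversalsInstance
  ; Yes      = λ I → let open ReversalsInstance I in
                 ∃[ D′ ] Reversible k digraph D′ ×
                         (∃[ m ] Diameter D′ m × m ≤⁺ [ target ])
  ; encode   = encodeInstance
  }

{-# OPTIONS --safe #-}
-- A digraph obtained by at most k reversals is one of polynomially many, since
-- there are at most n² choices for each reversal.  Having diameter at most d
-- means that the relation "there is a walk of length at most d" is total, and
-- this relation is found by repeated squaring along the binary digits of d.
--
-- The procedure is written as an Agda function on lists.  Functions between
-- types of finite data are shown to be computable in polynomial time by closure
-- under composition, pairing, branching and those folds whose accumulator grows
-- by a bounded amount in each step.  Each such function is realised by a
-- structured program on three stacks, which are the tapes of a Turing machine.
module Submission where

open import Defs
open import Data.Bool using (Bool; true; false; T; if_then_else_; not; _∧_; _∨_)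
open import Data.Bool.ListAction using (any; all)
open import Data.Bool.Properties using (T?; T-∧; T-∨)
open import Data.Digit using (Bit; fromDigits; toDigits)
open import Data.Empty using (⊥-elim)
open import Data.Fin using (Fin; zero; suc; toℕ; join; splitAt; _≟_)
open import Data.Fin.Properties using (splitAt-join; toℕ-injective; toℕ≤n; any?)
open import Data.List using (List; []; _∷_; [_]; _++_; _ʳ++_; head; drop; map; length; foldl; foldr; reverse; concatMap; filterᵇ; null; tabulate; allFin; replicate)
open import Data.List.Membership.DecPropositional using () renaming (_∈?_ to mem?)
open import Data.List.Membership.Propositional using (_∈_; find; lose)
open import Data.List.Membership.Propositional.Properties using (∈-map⁺; ∈-map⁻; ∈-filter⁺; ∈-filter⁻; ∈-concatMap⁺; ∈-concatMap⁻)
open import Data.List.Properties using (length-++; ++-assoc; ++-identityʳ; ++-ʳ++; ʳ++-ʳ++; length-ʳ++; reverse-foldl; drop-[]; length-drop; length-replicate; map-tabulate; map-∘; map-cong)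
open import Data.List.Relation.Unary.All using (All; []; _∷_) renaming (lookup to lookupᵃ; tabulate to tabulateᵃ)
open import Data.List.Relation.Unary.All.Properties using (all⁺; all⁻; ¬Any⇒All¬)
open import Data.List.Relation.Unary.AllPairs using ([]; _∷_)
open import Data.List.Relation.Unary.Any using (here; there)
open import Data.List.Relation.Unary.Any.Properties using (any⁺; any⁻)
open import Data.List.Relation.Unary.Unique.Propositional using (Unique)
open import Data.Maybe using (Maybe; just; nothing; maybe; is-just) renaming (map to mapᵐ)
open import Data.Nat using (ℕ; zero; suc; _+_; _*_; _∸_; _^_; _≤_; z≤n; s≤s)
open import Data.Nat.Properties hiding (_≟_)
open import Data.Nat.Solver using (module +-*-Solver)
open import Data.Product using (_×_; _,_; proj₁; proj₂; ∃-syntax; Σ-syntax; map₁; swap; uncurry; <_,_>)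
open import Data.Sum using (_⊎_; inj₁; inj₂) renaming (map to map⊎)
open import Data.Unit using (⊤; tt)
open import Data.Vec using (Vec; []; _∷_; updateAt; zipWith) renaming (lookup to lookupᵛ; map to mapᵛ; replicate to replicateᵛ)
open import Data.Vec.Relation.Binary.Pointwise.Inductive using (Pointwise; []; _∷_)
open import Function using (_∘_; id; const)
open import Function.Bundles using (Equivalence)
open import Relation.Binary.Construct.Add.Supremum.NonStrict _≤_ using (_≤⁺_; [≤]-injective; ≤⁺-trans) renaming ([_] to ⁺[_])
open import Relation.Binary.Construct.Closure.ReflexiveTransitive using (ε; _◅_; _◅◅_)
open import Relation.Binary.PropositionalEquality using (_≡_; _≗_; refl; sym; trans; cong; cong₂; subst; subst₂; module ≡-Reasoning)
open import Relation.Nullary using (¬_; Dec; yes; no; contradiction; does)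
open import Relation.Nullary.Construct.Add.Supremum using (⊤⁺) renaming ([_] to fin)
open import Relation.Nullary.Decidable using (map′; _×-dec_; _⊎-dec_; decidable-stable)

-- Stack programs and their compilation to Turing machines

-- The given diameter may be `⊤⁺`, so the target is not bounded by the number of vertices, while its
-- code has only logarithmic length. A loop over all lengths up to the target could take exponential
-- time, whereas a relation on vertices never exceeds the set of all pairs, however large the
-- target. Distance is defined by simple paths, which cannot be concatenated freely; the relations
-- therefore speak of walks, and removal of loops connects the two. Running time cannot be read off
-- an Agda function, so each function is rebuilt by combinators along its definition. `Computable`
-- keeps a bound on the size of the output next to the one on time, since the next function of a
-- composition is charged by that size. The number k is not part of the input: the k rounds of
-- reversals form a composition of fixed length, whose polynomial may depend on k.

pattern `0 = bit false
pattern `1 = bit true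

Stacks : ℕ → Set
Stacks = Vec (List Symbol)

infixr 5 _⨾_

data Program (m : ℕ) : Set where
  skip   : Program m
  push   : Fin m → Symbol → Program m
  pop    : Fin m → Program m
  _⨾_    : Program m → Program m → Program m
  branch : Fin m → (Maybe Symbol → Bool) → Program m → Program m → Program m
  while  : Fin m → (Maybe Symbol → Bool) → Program m → Program m

symbol : Cell 0 → Maybe Symbol
symbol blank     = nothing
symbol (input s) = just s

module _ {m : ℕ} where

  -- The last index bounds the number of machine steps, and `relax` makes it an upper bound only. A
  -- push costs 2 because the head first moves left and then writes; each test costs 1; leaving a
  -- program and entering the next costs nothing extra.
  data Exec : Program m → Stacks m → Stacks m → ℕ → Set where
    skip   : ∀ {σ} → Exec skip σ σ 1
    push   : ∀ {i s σ τ} → updateAt σ i (s ∷_) ≡ τ → Exec (push i s) σ τ 2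
    pop    : ∀ {i σ τ} → updateAt σ i (drop 1) ≡ τ → Exec (pop i) σ τ 1
    _⨾_    : ∀ {p q σ τ υ t t′} → Exec p σ τ t → Exec q τ υ t′ → Exec (p ⨾ q) σ υ (t + t′)
    branch : ∀ {i b p q xs σ τ t} → lookupᵛ σ i ≡ xs →
             Exec (if b (head xs) then p else q) σ τ t → Exec (branch i b p q) σ τ (suc t)
    stop   : ∀ {i b p xs σ} → lookupᵛ σ i ≡ xs → b (head xs) ≡ false →
             Exec (while i b p) σ σ 1
    loop   : ∀ {i b p xs σ τ υ t t′} → lookupᵛ σ i ≡ xs → b (head xs) ≡ true →
             Exec p σ τ t → Exec (while i b p) τ υ t′ → Exec (while i b p) σ υ (suc (t + t′))
    relax  : ∀ {p σ τ t t′} → t ≤ t′ → Exec p σ τ t → Exec p σ τ t′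

  Heads : Set
  Heads = Vec (Cell 0) m

  Actions : Set
  Actions = Vec (Cell 0 × Move) m

  Tapes : Set
  Tapes = Vec (Tape 0) m

  stateCount : Program m → ℕ
  stateCount skip             = 1
  stateCount (push _ _)       = 2
  stateCount (pop _)          = 1
  stateCount (p ⨾ q)          = stateCount p + stateCount q
  stateCount (branch _ _ p q) = 1 + (stateCount p + stateCount q)
  stateCount (while _ _ p)    = 1 + stateCount p

  -- Control states follow the syntax as sums, so `transition` recurses without index arithmetic;
  -- numbering by `toFin` enters only in `machine`.
  State : Program m → Set
  State skip             = Fin 1
  State (push _ _)       = Fin 2
  State (pop _)          = Fin 1
  State (p ⨾ q)          = State p ⊎ State q
  State (branch _ _ p q) = Fin 1 ⊎ (State p ⊎ State q)
  State (while _ _ p)    = Fin 1 ⊎ State p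

  toFin : ∀ p → State p → Fin (stateCount p)
  toFin skip             = id
  toFin (push _ _)       = id
  toFin (pop _)          = id
  toFin (p ⨾ q)          = join _ _ ∘ map⊎ (toFin p) (toFin q)
  toFin (branch _ _ p q) = join 1 _ ∘ map⊎ id (join _ _ ∘ map⊎ (toFin p) (toFin q))
  toFin (while _ _ p)    = join 1 _ ∘ map⊎ id (toFin p)

  fromFin : ∀ p → Fin (stateCount p) → State p
  fromFin skip             = id
  fromFin (push _ _)       = id
  fromFin (pop _)          = id
  fromFin (p ⨾ q)          = map⊎ (fromFin p) (fromFin q) ∘ splitAt _
  fromFin (branch _ _ p q) = map⊎ id (map⊎ (fromFin p) (fromFin q) ∘ splitAt _) ∘ splitAt 1
  fromFin (while _ _ p)    = map⊎ id (fromFin p) ∘ splitAt 1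

  fromFin-toFin : ∀ p s → fromFin p (toFin p s) ≡ s
  fromFin-toFin skip             s               = refl
  fromFin-toFin (push _ _)       s               = refl
  fromFin-toFin (pop _)          s               = refl
  fromFin-toFin (p ⨾ q)          s
    rewrite splitAt-join (stateCount p) (stateCount q) (map⊎ (toFin p) (toFin q) s) with s
  ... | inj₁ s′ = cong inj₁ (fromFin-toFin p s′)
  ... | inj₂ s′ = cong inj₂ (fromFin-toFin q s′)
  fromFin-toFin (branch _ _ p q) (inj₁ zero)     = refl
  fromFin-toFin (branch _ _ p q) (inj₂ s)
    rewrite splitAt-join (stateCount p) (stateCount q) (map⊎ (toFin p) (toFin q) s) with s
  ... | inj₁ s′ = cong (inj₂ ∘ inj₁) (fromFin-toFin p s′)
  ... | inj₂ s′ = cong (inj₂ ∘ inj₂) (fromFin-toFin q s′)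
  fromFin-toFin (while _ _ p)    (inj₁ zero)     = refl
  fromFin-toFin (while _ _ p)    (inj₂ s)        = cong inj₂ (fromFin-toFin p s)

  enter : ∀ p → State p
  enter skip             = zero
  enter (push _ _)       = zero
  enter (pop _)          = zero
  enter (p ⨾ q)          = inj₁ (enter p)
  enter (branch _ _ p q) = inj₁ zero
  enter (while _ _ p)    = inj₁ zero

  idle : Heads → Actions
  idle = mapᵛ (_, stay)

  actOn : Fin m → (Cell 0 → Cell 0 × Move) → Heads → Actions
  actOn i f hs = updateAt (idle hs) i (f ∘ proj₁)

  -- A successor state nothing means that the program has been left.
  transition : ∀ p → State p → Heads → Maybe (State p) × Actions
  transition skip             _               hs = nothing , idle hs
  transition (push i s)       zero            hs = just (suc zero) , actOn i (_, left) hs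
  transition (push i s)       (suc zero)      hs = nothing , actOn i (const (input s , stay)) hs
  transition (pop i)          _               hs = nothing , actOn i (const (blank , right)) hs
  transition (p ⨾ q)          (inj₁ s)        hs =
    map₁ (just ∘ maybe inj₁ (inj₂ (enter q))) (transition p s hs)
  transition (p ⨾ q)          (inj₂ s)        hs = map₁ (mapᵐ inj₂) (transition q s hs)
  transition (branch i b p q) (inj₁ _)        hs =
    just (inj₂ (if b (symbol (lookupᵛ hs i)) then inj₁ (enter p) else inj₂ (enter q))) , idle hs
  transition (branch i b p q) (inj₂ (inj₁ s)) hs =
    map₁ (mapᵐ (inj₂ ∘ inj₁)) (transition p s hs)
  transition (branch i b p q) (inj₂ (inj₂ s)) hs =
    map₁ (mapᵐ (inj₂ ∘ inj₂)) (transition q s hs)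
  transition (while i b p)    (inj₁ _)        hs =
    (if b (symbol (lookupᵛ hs i)) then just (inj₂ (enter p)) else nothing) , idle hs
  transition (while i b p)    (inj₂ s)        hs =
    map₁ (just ∘ maybe inj₂ (inj₁ zero)) (transition p s hs)

  data Run (p : Program m) : Maybe (State p) → Tapes → Tapes → ℕ → Set where
    exit : ∀ {ts} → Run p nothing ts ts 0
    go   : ∀ {s s′ as ts ts′ ts″ t} → transition p s (mapᵛ Tape.head ts) ≡ (s′ , as) →
           zipWith act as ts ≡ ts′ → Run p s′ ts′ ts″ t → Run p (just s) ts ts″ (suc t)

  -- The exit `nothing` of `p` is identified with the entry of `q`. The transition that leaves `p`
  -- is thus the one that enters `q`, and the times simply add.
  run-first : ∀ {p q s ts ts′ ts″ t t′} → Run p s ts ts′ t →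
              Run (p ⨾ q) (just (inj₂ (enter q))) ts′ ts″ t′ →
              Run (p ⨾ q) (just (maybe inj₁ (inj₂ (enter q)) s)) ts ts″ (t + t′)
  run-first exit          r′ = r′
  run-first (go eq eq′ r) r′ = go (cong (map₁ _) eq) eq′ (run-first r r′)

  run-second : ∀ {p q s ts ts′ t} → Run q s ts ts′ t → Run (p ⨾ q) (mapᵐ inj₂ s) ts ts′ t
  run-second exit          = exit
  run-second (go eq eq′ r) = go (cong (map₁ _) eq) eq′ (run-second r)

  run-then : ∀ {i b p q s ts ts′ t} → Run p s ts ts′ t →
             Run (branch i b p q) (mapᵐ (inj₂ ∘ inj₁) s) ts ts′ t
  run-then exit          = exit
  run-then (go eq eq′ r) = go (cong (map₁ _) eq) eq′ (run-then r)

  run-else : ∀ {i b p q s ts ts′ t} → Run q s ts ts′ t →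
             Run (branch i b p q) (mapᵐ (inj₂ ∘ inj₂) s) ts ts′ t
  run-else exit          = exit
  run-else (go eq eq′ r) = go (cong (map₁ _) eq) eq′ (run-else r)

  run-body : ∀ {i b p s ts ts′ ts″ t t′} → Run p s ts ts′ t →
             Run (while i b p) (just (inj₁ zero)) ts′ ts″ t′ →
             Run (while i b p) (just (maybe inj₂ (inj₁ zero) s)) ts ts″ (t + t′)
  run-body exit          r′ = r′
  run-body (go eq eq′ r) r′ = go (cong (map₁ _) eq) eq′ (run-body r r′)

-- Tapes that hold stacks

data Holds : List (Cell 0) → List Symbol → Set where
  []  : ∀ {cs} → All (_≡ blank) cs → Holds cs []
  _∷_ : ∀ {cs xs} x → Holds cs xs → Holds (input x ∷ cs) (x ∷ xs)

-- The top of the stack is under the head.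
data Represents : Tape 0 → List Symbol → Set where
  rep : ∀ {ls c rs xs} → All (_≡ blank) ls → Holds (c ∷ rs) xs → Represents (tape ls c rs) xs

push-represents : ∀ {t xs} s → Represents t xs →
  let t′ = act (Tape.head t , left) t in Represents (act (input s , stay) t′) (s ∷ xs)
push-represents s (rep []         h) = rep [] (s ∷ h)
push-represents s (rep (refl ∷ b) h) = rep b (s ∷ h)

pop-represents : ∀ {t xs} → Represents t xs → Represents (act (blank , right) t) (drop 1 xs)
pop-represents {tape _ _ []}    (rep b ([] _))              = rep (refl ∷ b) ([] (refl ∷ []))
pop-represents {tape _ _ (_ ∷ _)} (rep b ([] (_ ∷ c)))      = rep (refl ∷ b) ([] c)
pop-represents {tape _ _ []}    (rep b (x ∷ [] []))         = rep (refl ∷ b) ([] (refl ∷ []))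
pop-represents {tape _ _ (_ ∷ _)} (rep b (x ∷ h))           = rep (refl ∷ b) h

idle-id : ∀ {m} (ts : Tapes {m}) → zipWith act (idle (mapᵛ Tape.head ts)) ts ≡ ts
idle-id []       = refl
idle-id (t ∷ ts) = cong (t ∷_) (idle-id ts)

actOn-updateAt : ∀ {m} i f (ts : Tapes {m}) →
  zipWith act (actOn i f (mapᵛ Tape.head ts)) ts ≡ updateAt ts i (λ t → act (f (Tape.head t)) t)
actOn-updateAt zero    f (t ∷ ts) = cong (_ ∷_) (idle-id ts)
actOn-updateAt (suc i) f (t ∷ ts) = cong (t ∷_) (actOn-updateAt i f ts)

updateAt-represents : ∀ {m} i {f g} {ts : Tapes {m}} {σ} →
  (∀ {t xs} → Represents t xs → Represents (f t) (g xs)) →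
  Pointwise Represents ts σ → Pointwise Represents (updateAt ts i f) (updateAt σ i g)
updateAt-represents zero    h (r ∷ rs) = h r ∷ rs
updateAt-represents (suc i) h (r ∷ rs) = r ∷ updateAt-represents i h rs

updateAt-twice : ∀ {m} i f g (ts : Tapes {m}) →
  updateAt (updateAt ts i f) i g ≡ updateAt ts i (g ∘ f)
updateAt-twice zero    f g (t ∷ ts) = refl
updateAt-twice (suc i) f g (t ∷ ts) = cong (t ∷_) (updateAt-twice i f g ts)

symbol-lookup : ∀ {m} i {ts : Tapes {m}} {σ xs} → Pointwise Represents ts σ → lookupᵛ σ i ≡ xs →
                symbol (lookupᵛ (mapᵛ Tape.head ts) i) ≡ head xs
symbol-lookup zero    (rep _ ([] (refl ∷ _)) ∷ rs) refl = refl
symbol-lookup zero    (rep _ (x ∷ _) ∷ rs)         refl = refl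
symbol-lookup (suc i) (r ∷ rs) eq   = symbol-lookup i rs eq

module _ {m : ℕ} where

  -- The exact length `t′` of the run is existential, since `t` stems from an `Exec` and may be
  -- larger.
  Terminates : ∀ (p : Program m) → Tapes → Stacks m → ℕ → Set
  Terminates p ts τ t =
    ∃[ ts′ ] ∃[ t′ ] t′ ≤ t × Run p (just (enter p)) ts ts′ t′ × Pointwise Represents ts′ τ

  exec-terminates : ∀ {p : Program m} {σ τ t ts} → Exec p σ τ t → Pointwise Represents ts σ →
                    Terminates p ts τ t
  exec-terminates {ts = ts} skip rs = ts , 1 , ≤-refl , go refl (idle-id ts) exit , rs
  exec-terminates {ts = ts} (push {i} {s} refl) rs =
    _ , 2 , ≤-refl ,
    go refl (actOn-updateAt i _ ts)
      (go refl (trans (actOn-updateAt i _ _) (updateAt-twice i _ _ ts)) exit) ,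
    updateAt-represents i (push-represents s) rs
  exec-terminates {ts = ts} (pop {i} refl) rs =
    _ , 1 , ≤-refl , go refl (actOn-updateAt i _ ts) exit , updateAt-represents i pop-represents rs
  exec-terminates (_⨾_ {p} {q} e e′) rs with exec-terminates e rs
  ... | ts′ , t₁ , le₁ , r₁ , rs′ with exec-terminates e′ rs′
  ... | ts″ , t₂ , le₂ , r₂ , rs″ =
    ts″ , t₁ + t₂ , +-mono-≤ le₁ le₂ , run-first r₁ (run-second r₂) , rs″
  exec-terminates {ts = ts} (branch {i} {b} {xs = xs} eq e) rs
    with b (head xs) in eqᵇ | exec-terminates e rs
  ... | true  | ts′ , t , le , r , rs′ = ts′ , suc t , s≤s le ,
    go (cong (λ c → just (inj₂ (if c then _ else _)) , _)
             (trans (cong b (symbol-lookup i rs eq)) eqᵇ)) (idle-id ts) (run-then r) , rs′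
  ... | false | ts′ , t , le , r , rs′ = ts′ , suc t , s≤s le ,
    go (cong (λ c → just (inj₂ (if c then _ else _)) , _)
             (trans (cong b (symbol-lookup i rs eq)) eqᵇ)) (idle-id ts) (run-else r) , rs′
  exec-terminates {ts = ts} (stop {i} {b} eq eqᵇ) rs = ts , 1 , ≤-refl ,
    go (cong (λ c → (if c then _ else _) , _) (trans (cong b (symbol-lookup i rs eq)) eqᵇ))
       (idle-id ts) exit , rs
  exec-terminates {ts = ts} (loop {i} {b} eq eqᵇ e e′) rs with exec-terminates e rs
  ... | ts′ , t₁ , le₁ , r₁ , rs′ with exec-terminates e′ rs′
  ... | ts″ , t₂ , le₂ , r₂ , rs″ = ts″ , suc (t₁ + t₂) , s≤s (+-mono-≤ le₁ le₂) ,
    go (cong (λ c → (if c then _ else _) , _) (trans (cong b (symbol-lookup i rs eq)) eqᵇ))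
       (idle-id ts) (run-body r₁ r₂) , rs″
  exec-terminates (relax le e) rs with exec-terminates e rs
  ... | ts′ , t , le′ , r , rs′ = ts′ , t , ≤-trans le′ le , r , rs′

isOne : Maybe Symbol → Bool
isOne (just `1) = true
isOne _         = false

-- State `zero` is added to those of the program. It is entered on exit and turns the top of the
-- first stack into the verdict. No work symbols occur: the stacks hold symbols of the input
-- alphabet.
machine : ∀ {l} → Program (suc l) → TuringMachine
machine {l} p = record
  { extraTapes  = l
  ; workSymbols = 0
  ; states      = suc (stateCount p)
  ; start       = running (suc (toFin p (enter p)))
  ; δ           = λ where
      zero    hs → (if isOne (symbol (lookupᵛ hs zero)) then accept else reject) , idle hs
      (suc s) hs → map₁ (running ∘ maybe (suc ∘ toFin p) zero) (transition p (fromFin p s) hs)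
  }

-- `run` takes its steps from the front, so the time `t′` left after the exit is carried through the
-- induction.
run-machine : ∀ {l} {p : Program (suc l)} {s ts ts′ t} → Run p s ts ts′ t → ∀ t′ →
  run (machine p) (t + t′) (config (running (maybe (suc ∘ toFin p) zero s)) ts) ≡
  run (machine p) t′ (config (running zero) ts′)
run-machine exit t′ = refl
run-machine {p = p} (go {s = s} eq refl r) t′
  rewrite fromFin-toFin p s | eq = run-machine r t′

holds-input : ∀ w → Holds (map input w) w
holds-input []      = [] []
holds-input (s ∷ w) = s ∷ holds-input w

input-represents : ∀ w → Represents (inputTape w) w
input-represents []      = rep [] ([] (refl ∷ []))
input-represents (s ∷ w) = rep [] (s ∷ holds-input w)

blank-represents : ∀ l → Pointwise Represents (replicateᵛ l blankTape) (replicateᵛ l [])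
blank-represents zero    = []
blank-represents (suc l) = rep [] ([] (refl ∷ [])) ∷ blank-represents l

decides : ∀ {l} {p : Program (suc l)} {w xs σ t} →
  Exec p (w ∷ replicateᵛ l []) (xs ∷ σ) t →
  ∃[ t′ ] t′ ≤ suc t × outcome (machine p) t′ w ≡ (if isOne (head xs) then accept else reject)
decides {l} {p} {w} {xs} e
  with ts , t , le , r , rs@(_ ∷ _) ← exec-terminates e (input-represents w ∷ blank-represents l) =
  -- The additional step is the one taken in state `zero`.
  t + 1 , ≤-trans (≤-reflexive (+-suc t 0)) (s≤s (≤-trans (≤-reflexive (+-identityʳ t)) le)) ,
  trans (cong Config.control (run-machine r 1))
        (cong (λ s → if isOne s then accept else reject) (symbol-lookup zero rs refl))

-- Polynomial bounds, and values encoded on a stack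

infixl 6 _⊕_
infixl 7 _⊗_
infixr 9 _⊚_

-- Natural coefficients and the absence of subtraction make every bound monotone, so an estimate of
-- a size can be substituted into it. Composition is a constructor because the time of a second
-- function is evaluated at the size of the output of the first.
data Polynomial : Set where
  X           : Polynomial
  con         : ℕ → Polynomial
  _⊕_ _⊗_ _⊚_ : Polynomial → Polynomial → Polynomial

⟪_⟫ : Polynomial → ℕ → ℕ
⟪ X ⟫     n = n
⟪ con c ⟫ n = c
⟪ p ⊕ q ⟫ n = ⟪ p ⟫ n + ⟪ q ⟫ n
⟪ p ⊗ q ⟫ n = ⟪ p ⟫ n * ⟪ q ⟫ n
⟪ p ⊚ q ⟫ n = ⟪ p ⟫ (⟪ q ⟫ n)

⟪⟫-mono : ∀ p {m n} → m ≤ n → ⟪ p ⟫ m ≤ ⟪ p ⟫ n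
⟪⟫-mono X       m≤n = m≤n
⟪⟫-mono (con c) m≤n = ≤-refl
⟪⟫-mono (p ⊕ q) m≤n = +-mono-≤ (⟪⟫-mono p m≤n) (⟪⟫-mono q m≤n)
⟪⟫-mono (p ⊗ q) m≤n = *-mono-≤ (⟪⟫-mono p m≤n) (⟪⟫-mono q m≤n)
⟪⟫-mono (p ⊚ q) m≤n = ⟪⟫-mono p (⟪⟫-mono q m≤n)

^-raise : ∀ n {d e} → d ≤ e → suc n ^ d ≤ suc n ^ e
^-raise n = ^-monoʳ-≤ (suc n)

^-*-distrib : ∀ m n e → (m * n) ^ e ≡ m ^ e * n ^ e
^-*-distrib m n zero    = refl
^-*-distrib m n (suc e) rewrite ^-*-distrib m n e =
  solve 4 (λ m n a b → m :* n :* (a :* b) := m :* a :* (n :* b)) refl m n (m ^ e) (n ^ e)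
  where open +-*-Solver

-- The base `suc n` is positive, so its powers increase with the exponent and absorb constants, even
-- for `n = 0`; this is what lets exponents be added and multiplied crudely.
⟪⟫-degree : ∀ p → ∃[ c ] ∃[ e ] ∀ n → ⟪ p ⟫ n ≤ c * suc n ^ e
⟪⟫-degree X       = 1 , 1 , λ n → ≤-trans (n≤1+n n)
  (≤-reflexive (sym (trans (*-identityˡ (suc n ^ 1)) (^-identityʳ (suc n)))))
⟪⟫-degree (con c) = c , 0 , λ n → ≤-reflexive (sym (*-identityʳ c))
⟪⟫-degree (p ⊕ q) with ⟪⟫-degree p | ⟪⟫-degree q
... | c , d , le | c′ , d′ , le′ = c + c′ , d + d′ , λ n → begin
  ⟪ p ⟫ n + ⟪ q ⟫ n                         ≤⟨ +-mono-≤ (le n) (le′ n) ⟩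
  c * suc n ^ d + c′ * suc n ^ d′           ≤⟨ +-mono-≤ (*-monoʳ-≤ c (^-raise n (m≤m+n d d′)))
                                                        (*-monoʳ-≤ c′ (^-raise n (m≤n+m d′ d))) ⟩
  c * suc n ^ (d + d′) + c′ * suc n ^ (d + d′) ≡⟨ *-distribʳ-+ (suc n ^ (d + d′)) c c′ ⟨
  (c + c′) * suc n ^ (d + d′)               ∎
  where open ≤-Reasoning
⟪⟫-degree (p ⊗ q) with ⟪⟫-degree p | ⟪⟫-degree q
... | c , d , le | c′ , d′ , le′ = c * c′ , d + d′ , λ n → begin
  ⟪ p ⟫ n * ⟪ q ⟫ n                   ≤⟨ *-mono-≤ (le n) (le′ n) ⟩
  c * suc n ^ d * (c′ * suc n ^ d′)   ≡⟨ solve 4 (λ a b c d → a :* b :* (c :* d) := a :* c :* (b :* d))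
                                           refl c (suc n ^ d) c′ (suc n ^ d′) ⟩
  c * c′ * (suc n ^ d * suc n ^ d′)   ≡⟨ cong (c * c′ *_) (^-distribˡ-+-* (suc n) d d′) ⟨
  c * c′ * suc n ^ (d + d′)           ∎
  where open ≤-Reasoning ; open +-*-Solver
⟪⟫-degree (p ⊚ q) with ⟪⟫-degree p | ⟪⟫-degree q
... | c , d , le | c′ , d′ , le′ = c * suc c′ ^ d , d′ * d , λ n → begin
  ⟪ p ⟫ (⟪ q ⟫ n)                      ≤⟨ le (⟪ q ⟫ n) ⟩
  c * suc (⟪ q ⟫ n) ^ d                ≤⟨ *-monoʳ-≤ c (^-monoˡ-≤ d (s≤s (le′ n))) ⟩
  c * suc (c′ * suc n ^ d′) ^ d        ≤⟨ *-monoʳ-≤ c (^-monoˡ-≤ d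
                                            (+-monoˡ-≤ (c′ * suc n ^ d′) (m^n>0 (suc n) d′))) ⟩
  c * (suc c′ * suc n ^ d′) ^ d        ≡⟨ cong (c *_) (^-*-distrib (suc c′) (suc n ^ d′) d) ⟩
  c * (suc c′ ^ d * (suc n ^ d′) ^ d)  ≡⟨ cong (λ x → c * (suc c′ ^ d * x)) (^-*-assoc (suc n) d′ d) ⟩
  c * (suc c′ ^ d * suc n ^ (d′ * d))  ≡⟨ *-assoc c (suc c′ ^ d) (suc n ^ (d′ * d)) ⟨
  c * suc c′ ^ d * suc n ^ (d′ * d)    ∎
  where open ≤-Reasoning

-- The factor `2 ^ e` comes from `suc n ≤ 2 * n` for positive `n`; the additive constant covers
-- `n = 0`.
⟪⟫-bound : ∀ p → ∃[ c ] ∃[ e ] ∀ n → ⟪ p ⟫ n ≤ c * n ^ e + c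
⟪⟫-bound p with ⟪⟫-degree p
... | c , e , le = c * 2 ^ e , e , bound
  where
  open ≤-Reasoning
  bound : ∀ n → ⟪ p ⟫ n ≤ c * 2 ^ e * n ^ e + c * 2 ^ e
  bound zero = begin
    ⟪ p ⟫ 0                          ≤⟨ le 0 ⟩
    c * 1 ^ e                        ≡⟨ cong (c *_) (^-zeroˡ e) ⟩
    c * 1                            ≤⟨ *-monoʳ-≤ c (m^n>0 2 e) ⟩
    c * 2 ^ e                        ≤⟨ m≤n+m (c * 2 ^ e) _ ⟩
    c * 2 ^ e * 0 ^ e + c * 2 ^ e    ∎
  bound n@(suc n-1) = begin
    ⟪ p ⟫ n                          ≤⟨ le n ⟩
    c * suc n ^ e                    ≤⟨ *-monoʳ-≤ c (^-monoˡ-≤ e (s≤s (m≤n+m n n-1))) ⟩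
    c * (n + n) ^ e                  ≡⟨ cong (λ m → c * m ^ e) (cong (n +_) (sym (+-identityʳ n))) ⟩
    c * (2 * n) ^ e                  ≡⟨ cong (c *_) (^-*-distrib 2 n e) ⟩
    c * (2 ^ e * n ^ e)              ≡⟨ *-assoc c (2 ^ e) (n ^ e) ⟨
    c * 2 ^ e * n ^ e                ≤⟨ m≤m+n _ (c * 2 ^ e) ⟩
    c * 2 ^ e * n ^ e + c * 2 ^ e    ∎

infixr 6 _`×_

data Type : Set where
  `⊤ `Bool `Symbol : Type
  _`×_             : Type → Type → Type
  `List            : Type → Type

⟦_⟧ : Type → Set
⟦ `⊤ ⟧      = ⊤
⟦ `Bool ⟧   = Bool
⟦ `Symbol ⟧ = Symbol
⟦ α `× β ⟧  = ⟦ α ⟧ × ⟦ β ⟧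
⟦ `List α ⟧ = List ⟦ α ⟧

-- Given the type, a code is self-delimiting, so a program can move or copy the
-- topmost item of a stack without knowing what lies below it.
enc  : ∀ α → ⟦ α ⟧ → List Symbol
enc* : ∀ α → List ⟦ α ⟧ → List Symbol

enc `⊤        _       = []
enc `Bool     b       = bit b ∷ []
enc `Symbol   s       = s ∷ []
enc (α `× β)  (x , y) = enc α x ++ enc β y
enc (`List α) xs      = enc* α xs

enc* α []       = `0 ∷ []
enc* α (x ∷ xs) = `1 ∷ enc α x ++ enc* α xs

size : ∀ α → ⟦ α ⟧ → ℕ
size α x = length (enc α x)

size-× : ∀ α β x y → size (α `× β) (x , y) ≡ size α x + size β y
size-× α β x y = length-++ (enc α x)

size-∷ : ∀ α x xs → size (`List α) (x ∷ xs) ≡ suc (size α x + size (`List α) xs)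
size-∷ α x xs = cong suc (length-++ (enc α x))

length≤size : ∀ α xs → length xs ≤ size (`List α) xs
length≤size α []       = z≤n
length≤size α (x ∷ xs) rewrite size-∷ α x xs =
  s≤s (≤-trans (length≤size α xs) (m≤n+m _ (size α x)))

cast : ∀ {m} {p : Program m} {σ σ′ τ τ′ t} → σ ≡ σ′ → τ ≡ τ′ → Exec p σ τ t → Exec p σ′ τ′ t
cast refl refl e = e

pattern M = zero
pattern A = suc zero
pattern B = suc (suc zero)

-- κ x y is a family of stack contents with x on stack i and y on stack j.
record View (i j : Fin 3) (κ : List Symbol → List Symbol → Stacks 3) : Set where
  field
    source : ∀ {x y} → lookupᵛ (κ x y) i ≡ x
    popped : ∀ {s x y} → updateAt (κ (s ∷ x) y) i (drop 1) ≡ κ x y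
    pushed : ∀ {s x y} → updateAt (κ x y) j (s ∷_) ≡ κ x (s ∷ y)

stacks : List Symbol → List Symbol → List Symbol → Stacks 3
stacks m a b = m ∷ a ∷ b ∷ []

M→A : ∀ {b} → View M A (λ m a → stacks m a b)
M→A = record { source = refl ; popped = refl ; pushed = refl }

M→B : ∀ {a} → View M B (λ m b → stacks m a b)
M→B = record { source = refl ; popped = refl ; pushed = refl }

A→M : ∀ {b} → View A M (λ a m → stacks m a b)
A→M = record { source = refl ; popped = refl ; pushed = refl }

B→M : ∀ {a} → View B M (λ b m → stacks m a b)
B→M = record { source = refl ; popped = refl ; pushed = refl }

B→A : ∀ {m} → View B A (λ b a → stacks m a b)
B→A = record { source = refl ; popped = refl ; pushed = refl }

isZero : Maybe Symbol → Bool
isZero (just `0) = true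
isZero _         = false

-- A program has no register for the popped symbol, so it is remembered by the branch taken. The
-- longest branch costs two tests, a pop and a push, which makes 5.
xfer : Fin 3 → Fin 3 → Program 3
xfer i j = branch i isOne (pop i ⨾ push j `1)
             (branch i isZero (pop i ⨾ push j `0) (pop i ⨾ push j #))

transfer : Fin 3 → Fin 3 → Program 3
transfer i j = while i is-just (xfer i j)

-- Moving an item reverses its code, which then can no longer be parsed from the top. The way back
-- is therefore `transfer`, which empties a whole stack; this relies on the stacks `A` and `B` being
-- empty between computations.
move* : Type → Fin 3 → Fin 3 → Program 3
moveItem : Type → Fin 3 → Fin 3 → Program 3

move* α i j = while i isOne (xfer i j ⨾ moveItem α i j)

moveItem `⊤        i j = skip
moveItem `Bool     i j = xfer i j
moveItem `Symbol   i j = xfer i j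
moveItem (α `× β)  i j = moveItem α i j ⨾ moveItem β i j
moveItem (`List α) i j = move* α i j ⨾ xfer i j

-- The factor is charged on `1 + size`, because the unit type has an empty code and its `skip` still
-- takes a step. The 6 for lists pays for the loop test and the transfer of the tag in front of each
-- entry.
moveFactor : Type → ℕ
moveFactor `⊤        = 1
moveFactor `Bool     = 5
moveFactor `Symbol   = 5
moveFactor (α `× β)  = moveFactor α + moveFactor β
moveFactor (`List α) = 6 + moveFactor α

module _ {i j κ} (v : View i j κ) where
  open View v

  xfer-exec : ∀ s {x y} → Exec (xfer i j) (κ (s ∷ x) y) (κ x (s ∷ y)) 5
  xfer-exec `1 = relax (s≤s (s≤s (s≤s (s≤s z≤n)))) (branch source (pop popped ⨾ push pushed))
  xfer-exec `0 = branch source (branch source (pop popped ⨾ push pushed))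
  xfer-exec #  = branch source (branch source (pop popped ⨾ push pushed))

  transfer-exec : ∀ x {y} → Exec (transfer i j) (κ x y) (κ [] (x ʳ++ y)) (6 * length x + 1)
  transfer-exec []      = stop source refl
  transfer-exec (s ∷ x) =
    relax (≤-reflexive (cong (_+ 1) (sym (*-suc 6 (length x)))))
      (loop source refl (xfer-exec s) (transfer-exec x))

  -- The loop stops in front of the end tag, which stays on the source. The target contents `y′` are
  -- described by what they become once that tag has been moved as well.
  move*-exec : ∀ α xs {x y} → ∃[ y′ ] `0 ∷ y′ ≡ enc* α xs ʳ++ y ×
    Exec (move* α i j) (κ (enc* α xs ++ x) y) (κ (`0 ∷ x) y′) ((6 + moveFactor α) * size (`List α) xs)
  moveItem-exec : ∀ α a {x y} →
    Exec (moveItem α i j) (κ (enc α a ++ x) y) (κ x (enc α a ʳ++ y)) (moveFactor α * (1 + size α a))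

  move*-exec α []       {x} {y} = y , refl , relax (s≤s z≤n) (stop source refl)
  move*-exec α (a ∷ as) {x} {y} with move*-exec α as {x} {enc α a ʳ++ (`1 ∷ y)}
  ... | y′ , eq , e = y′ , trans eq (sym (++-ʳ++ (enc α a))) ,
    relax cost (loop source refl
      (xfer-exec `1 ⨾ cast (cong (λ z → κ z _) (sym (++-assoc (enc α a) _ x))) refl (moveItem-exec α a)) e)
    where
    open ≤-Reasoning
    open +-*-Solver
    k = moveFactor α
    cost : suc (5 + k * (1 + size α a) + (6 + k) * size (`List α) as) ≤
           (6 + k) * size (`List α) (a ∷ as)
    cost = begin
      suc (5 + k * (1 + size α a) + (6 + k) * size (`List α) as)
        ≤⟨ m≤n+m _ (6 * size α a) ⟩
      6 * size α a + suc (5 + k * (1 + size α a) + (6 + k) * size (`List α) as)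
        ≡⟨ solve 3 (λ k n m → con 6 :* n :+ (con 1 :+ (con 5 :+ k :* (con 1 :+ n) :+ (con 6 :+ k) :* m))
                             := (con 6 :+ k) :* (con 1 :+ (n :+ m))) refl k (size α a) _ ⟩
      (6 + k) * suc (size α a + size (`List α) as)
        ≡⟨ cong ((6 + k) *_) (size-∷ α a as) ⟨
      (6 + k) * size (`List α) (a ∷ as) ∎

  moveItem-exec `⊤        a       = skip
  moveItem-exec `Bool     b       = relax (m≤m+n 5 5) (xfer-exec (bit b))
  moveItem-exec `Symbol   s       = relax (m≤m+n 5 5) (xfer-exec s)
  moveItem-exec (α `× β)  (a , b) {x} {y} =
    relax cost (cast
      (cong (λ z → κ z y) (sym (++-assoc (enc α a) (enc β b) x)))
      (cong (κ x) (sym (++-ʳ++ (enc α a))))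
      (moveItem-exec α a ⨾ moveItem-exec β b))
    where
    open ≤-Reasoning
    k = moveFactor α
    l = moveFactor β
    cost : k * (1 + size α a) + l * (1 + size β b) ≤ (k + l) * (1 + size (α `× β) (a , b))
    cost = begin
      k * (1 + size α a) + l * (1 + size β b)
        ≤⟨ +-mono-≤ (*-monoʳ-≤ k (s≤s (m≤m+n (size α a) (size β b))))
                    (*-monoʳ-≤ l (s≤s (m≤n+m (size β b) (size α a)))) ⟩
      k * (1 + (size α a + size β b)) + l * (1 + (size α a + size β b))
        ≡⟨ *-distribʳ-+ (1 + (size α a + size β b)) k l ⟨
      (k + l) * (1 + (size α a + size β b))
        ≡⟨ cong (λ n → (k + l) * (1 + n)) (size-× α β a b) ⟨
      (k + l) * (1 + size (α `× β) (a , b)) ∎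
  moveItem-exec (`List α) as      {x} {y} with y′ , eq , e ← move*-exec α as {x} {y} =
    relax cost (cast refl (cong (κ x) eq) (e ⨾ xfer-exec `0))
    where
    open ≤-Reasoning
    k = 6 + moveFactor α
    cost : k * size (`List α) as + 5 ≤ k * (1 + size (`List α) as)
    cost = begin
      k * size (`List α) as + 5  ≤⟨ +-monoʳ-≤ (k * size (`List α) as) (m≤m+n 5 (1 + moveFactor α)) ⟩
      k * size (`List α) as + k  ≡⟨ +-comm (k * size (`List α) as) k ⟩
      k + k * size (`List α) as  ≡⟨ *-suc k _ ⟨
      k * (1 + size (`List α) as) ∎

-- Functions computable in polynomial time

-- The arbitrary rest `m` below the argument lets the same program act on the first component of a
-- pair (`firstᶜ`). `space` bounds the size of the result, not the memory in use.
record Computable (α β : Type) (f : ⟦ α ⟧ → ⟦ β ⟧) : Set where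
  field
    program : Program 3
    time    : Polynomial
    space   : Polynomial
    correct : ∀ a {m} → Exec program (stacks (enc α a ++ m) [] []) (stacks (enc β (f a) ++ m) [] [])
                             (⟪ time ⟫ (size α a))
    small   : ∀ a → size β (f a) ≤ ⟪ space ⟫ (size α a)

open Computable

private variable
  α β γ δ : Type

_≗ᶜ_ : ∀ {f g : ⟦ α ⟧ → ⟦ β ⟧} → Computable α β f → f ≗ g → Computable α β g
_≗ᶜ_ {β = β} F eq = record
  { program = program F ; time = time F ; space = space F
  ; correct = λ a {m} → cast refl (cong (λ b → stacks (enc β b ++ m) [] []) (eq a)) (correct F a)
  ; small   = λ a → subst (λ b → size β b ≤ _) (eq a) (small F a)
  }

idᶜ : Computable α α id
idᶜ = record
  { program = skip ; time = con 1 ; space = X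
  ; correct = λ a → skip
  ; small   = λ a → ≤-refl
  }

infixr 9 _∘ᶜ_

_∘ᶜ_ : ∀ {f : ⟦ β ⟧ → ⟦ γ ⟧} {g : ⟦ α ⟧ → ⟦ β ⟧} →
       Computable β γ f → Computable α β g → Computable α γ (f ∘ g)
_∘ᶜ_ {g = g} F G = record
  { program = program G ⨾ program F
  ; time    = time G ⊕ time F ⊚ space G
  ; space   = space F ⊚ space G
  ; correct = λ a → correct G a ⨾ relax (⟪⟫-mono (time F) (small G a)) (correct F (g a))
  ; small   = λ a → ≤-trans (small F (g a)) (⟪⟫-mono (space F) (small G a))
  }

restore : ∀ α a {m} → (enc α a ʳ++ []) ʳ++ m ≡ enc α a ++ m
restore α a = ʳ++-ʳ++ (enc α a)

size-ʳ++ : ∀ α a → length (enc α a ʳ++ []) ≡ size α a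
size-ʳ++ α a = trans (length-ʳ++ (enc α a)) (+-identityʳ _)

swapᶜ : Computable (α `× β) (β `× α) swap
swapᶜ {α} {β} = record
  { program = moveItem α M A ⨾ moveItem β M B ⨾ transfer A M ⨾ transfer B M
  ; time    = con (moveFactor α) ⊗ (con 1 ⊕ X) ⊕
              (con (moveFactor β) ⊗ (con 1 ⊕ X) ⊕ ((con 6 ⊗ X ⊕ con 1) ⊕ (con 6 ⊗ X ⊕ con 1)))
  ; space   = X
  ; correct = λ (a , b) {m} → relax (cost a b)
      (cast (cong (λ z → stacks z [] []) (sym (++-assoc (enc α a) (enc β b) m)))
            (cong (λ z → stacks z [] []) (trans (restore β b)
              (trans (cong (enc β b ++_) (restore α a)) (sym (++-assoc (enc β b) (enc α a) m)))))
            (moveItem-exec M→A α a ⨾ moveItem-exec M→B β b ⨾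
             transfer-exec A→M (enc α a ʳ++ []) ⨾ transfer-exec B→M (enc β b ʳ++ [])))
  ; small   = λ (a , b) → ≤-reflexive
      (trans (size-× β α b a) (trans (+-comm (size β b) _) (sym (size-× α β a b))))
  }
  where
  cost : ∀ a b → let n = size (α `× β) (a , b) in
    moveFactor α * (1 + size α a) + (moveFactor β * (1 + size β b) +
      ((6 * length (enc α a ʳ++ []) + 1) + (6 * length (enc β b ʳ++ []) + 1))) ≤
    moveFactor α * (1 + n) + (moveFactor β * (1 + n) + ((6 * n + 1) + (6 * n + 1)))
  cost a b rewrite size-ʳ++ α a | size-ʳ++ β b | size-× α β a b =
    +-mono-≤ (*-monoʳ-≤ (moveFactor α) (s≤s (m≤m+n _ _)))
      (+-mono-≤ (*-monoʳ-≤ (moveFactor β) (s≤s (m≤n+m _ _)))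
        (+-mono-≤ (+-monoˡ-≤ 1 (*-monoʳ-≤ 6 (m≤m+n (size α a) (size β b))))
                                  (+-monoˡ-≤ 1 (*-monoʳ-≤ 6 (m≤n+m (size β b) (size α a))))))

sndᶜ : Computable (α `× β) β proj₂
sndᶜ {α} {β} = record
  { program = moveItem α M A ⨾ while A is-just (pop A)
  ; time    = con (moveFactor α) ⊗ (con 1 ⊕ X) ⊕ (con 2 ⊗ X ⊕ con 1)
  ; space   = X
  ; correct = λ (a , b) {m} → relax (cost a b)
      (cast (cong (λ z → stacks z [] []) (sym (++-assoc (enc α a) (enc β b) m))) refl
            (moveItem-exec M→A α a ⨾ clear (enc α a ʳ++ [])))
  ; small   = λ (a , b) → ≤-trans (m≤n+m _ _) (≤-reflexive (sym (size-× α β a b)))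
  }
  where
  clear : ∀ x {m b} → Exec (while A is-just (pop A)) (stacks m x b) (stacks m [] b) (2 * length x + 1)
  clear []      = stop refl refl
  clear (s ∷ x) = relax (≤-reflexive (cong (_+ 1) (sym (*-suc 2 (length x)))))
    (loop refl refl (pop refl) (clear x))

  cost : ∀ a b → let n = size (α `× β) (a , b) in
    moveFactor α * (1 + size α a) + (2 * length (enc α a ʳ++ []) + 1) ≤
    moveFactor α * (1 + n) + (2 * n + 1)
  cost a b rewrite size-ʳ++ α a | size-× α β a b =
    +-mono-≤ (*-monoʳ-≤ (moveFactor α) (s≤s (m≤m+n _ _)))
      (+-monoˡ-≤ 1 (*-monoʳ-≤ 2 (m≤m+n (size α a) (size β b))))

dupᶜ : Computable α (α `× α) < id , id >
dupᶜ {α} = record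
  -- The code on `A` is reversed, so `copy` restores it on `M` and on `B`. The one on `B` passes
  -- through `A` in order to reach `M` with the right orientation.
  { program = moveItem α M A ⨾ copy ⨾ transfer B A ⨾ transfer A M
  ; time    = con (moveFactor α) ⊗ (con 1 ⊕ X) ⊕
              ((con 8 ⊗ X ⊕ con 1) ⊕ ((con 6 ⊗ X ⊕ con 1) ⊕ (con 6 ⊗ X ⊕ con 1)))
  ; space   = X ⊕ X
  ; correct = λ a {m} → relax (cost a)
      (cast refl
            (cong (λ z → stacks z [] []) (trans (restore α a)
              (trans (cong (enc α a ++_) (restore α a)) (sym (++-assoc (enc α a) (enc α a) m)))))
            (moveItem-exec M→A α a ⨾ copy-exec (enc α a ʳ++ []) ⨾
             cast (cong (stacks _ []) (sym (trans (restore α a) (++-identityʳ _)))) refl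
               (transfer-exec B→A (enc α a)) ⨾ transfer-exec A→M (enc α a ʳ++ [])))
  ; small   = λ a → ≤-reflexive (size-× α α a a)
  }
  where
  copy : Program 3
  copy = while A is-just
    (branch A isOne (pop A ⨾ push M `1 ⨾ push B `1)
      (branch A isZero (pop A ⨾ push M `0 ⨾ push B `0) (pop A ⨾ push M # ⨾ push B #)))

  copy-exec : ∀ x {m b} → Exec copy (stacks m x b) (stacks (x ʳ++ m) [] (x ʳ++ b)) (8 * length x + 1)
  copy-exec []       = stop refl refl
  copy-exec (s ∷ x) {m} {b} = relax (≤-reflexive (cong (_+ 1) (sym (*-suc 8 (length x)))))
    (loop refl refl (copy-top s) (copy-exec x))
    where
    copy-top : ∀ s → Exec _ (stacks m (s ∷ x) b) (stacks (s ∷ m) x (s ∷ b)) 7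
    copy-top `1 = relax (n≤1+n 6) (branch refl (pop refl ⨾ push refl ⨾ push refl))
    copy-top `0 = branch refl (branch refl (pop refl ⨾ push refl ⨾ push refl))
    copy-top #  = branch refl (branch refl (pop refl ⨾ push refl ⨾ push refl))

  cost : ∀ a → let n = size α a ; n′ = length (enc α a ʳ++ []) in
    moveFactor α * (1 + n) + ((8 * n′ + 1) + ((6 * n + 1) + (6 * n′ + 1))) ≤
    moveFactor α * (1 + n) + ((8 * n + 1) + ((6 * n + 1) + (6 * n + 1)))
  cost a rewrite size-ʳ++ α a = ≤-refl

firstᶜ : ∀ {f : ⟦ α ⟧ → ⟦ γ ⟧} → Computable α γ f → Computable (α `× β) (γ `× β) (map₁ f)
firstᶜ {α} {γ} {β} {f} F = record
  { program = program F
  ; time    = time F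
  ; space   = space F ⊕ X
  ; correct = λ (a , b) {m} → relax (⟪⟫-mono (time F) (size-≤ a b))
      (cast (cong (λ z → stacks z [] []) (sym (++-assoc (enc α a) (enc β b) m)))
            (cong (λ z → stacks z [] []) (sym (++-assoc (enc γ (f a)) (enc β b) m)))
            (correct F a))
  ; small   = λ (a , b) → ≤-trans (≤-reflexive (size-× γ β (f a) b))
      (+-mono-≤ (≤-trans (small F a) (⟪⟫-mono (space F) (size-≤ a b)))
                (≤-trans (m≤n+m _ _) (≤-reflexive (sym (size-× α β a b)))))
  }
  where
  size-≤ : ∀ a b → size α a ≤ size (α `× β) (a , b)
  size-≤ a b = ≤-trans (m≤m+n _ _) (≤-reflexive (sym (size-× α β a b)))

⟨_,_⟩ : ∀ {f : ⟦ α ⟧ → ⟦ β ⟧} {g : ⟦ α ⟧ → ⟦ γ ⟧} →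
        Computable α β f → Computable α γ g → Computable α (β `× γ) < f , g >
⟨ F , G ⟩ = swapᶜ ∘ᶜ firstᶜ G ∘ᶜ swapᶜ ∘ᶜ firstᶜ F ∘ᶜ dupᶜ

fstᶜ : Computable (α `× β) α proj₁
fstᶜ = sndᶜ ∘ᶜ swapᶜ

-- Pairing with `tt` does not change the code, so it costs a `skip`; discarding the first component
-- then leaves the empty code.
unitᶜ : Computable α `⊤ (const tt)
unitᶜ {α} = sndᶜ ∘ᶜ pad
  where
  pad : Computable α (α `× `⊤) (_, tt)
  pad = record
    { program = skip ; time = con 1 ; space = X
    ; correct = λ a {m} →
        cast refl (cong (λ z → stacks (z ++ m) [] []) (sym (++-identityʳ (enc α a)))) skip
    ; small   = λ a → ≤-reflexive (cong length (++-identityʳ (enc α a)))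
    }

-- This covers the constructors of booleans and lists, whose codes are one tag in front of the codes
-- of their arguments.
prefixᶜ : ∀ s (f : ⟦ α ⟧ → ⟦ β ⟧) → (∀ a → enc β (f a) ≡ s ∷ enc α a) → Computable α β f
prefixᶜ {α} {β} s f eq = record
  { program = push M s ; time = con 2 ; space = con 1 ⊕ X
  ; correct = λ a {m} → push (cong (λ z → stacks (z ++ m) [] []) (sym (eq a)))
  ; small   = λ a → ≤-reflexive (cong length (eq a))
  }

boolᶜ : ∀ b → Computable α `Bool (const b)
boolᶜ b = prefixᶜ (bit b) (const b) (λ _ → refl) ∘ᶜ unitᶜ

nilᶜ : Computable α (`List β) (const [])
nilᶜ = prefixᶜ `0 (const []) (λ _ → refl) ∘ᶜ unitᶜ

consᶜ : ∀ {f : ⟦ α ⟧ → ⟦ β ⟧} {g : ⟦ α ⟧ → List ⟦ β ⟧} →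
        Computable α β f → Computable α (`List β) g → Computable α (`List β) (λ a → f a ∷ g a)
consᶜ F G = prefixᶜ `1 (λ (x , xs) → x ∷ xs) (λ _ → refl) ∘ᶜ ⟨ F , G ⟩

-- Conditionals and case analysis on lists are the same program: the code starts with a tag, and
-- popping it leaves exactly the code of the argument of the chosen branch. The last hypothesis
-- expresses this for both.
branchᶜ : ∀ {f : ⟦ α ⟧ → ⟦ δ ⟧} {g : ⟦ β ⟧ → ⟦ δ ⟧} (h : ⟦ γ ⟧ → ⟦ δ ⟧) →
          Computable α δ f → Computable β δ g →
          (∀ c → (∃[ a ] enc γ c ≡ `1 ∷ enc α a × h c ≡ f a) ⊎
                 (∃[ b ] enc γ c ≡ `0 ∷ enc β b × h c ≡ g b)) →
          Computable γ δ h
branchᶜ {α} {δ} {β} {γ} {f} {g} h F G view = record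
  { program = branch M isOne (pop M ⨾ program F) (pop M ⨾ program G)
  ; time    = con 2 ⊕ (time F ⊕ time G)
  ; space   = space F ⊕ space G
  ; correct = λ c → exec c (view c)
  ; small   = λ c → bound c (view c)
  }
  where
  Case : ⟦ γ ⟧ → Set
  Case c = (∃[ a ] enc γ c ≡ `1 ∷ enc α a × h c ≡ f a) ⊎
            (∃[ b ] enc γ c ≡ `0 ∷ enc β b × h c ≡ g b)

  exec : ∀ c → Case c → ∀ {m} → Exec (branch M isOne (pop M ⨾ program F) (pop M ⨾ program G))
    (stacks (enc γ c ++ m) [] []) (stacks (enc δ (h c) ++ m) [] [])
    (2 + (⟪ time F ⟫ (size γ c) + ⟪ time G ⟫ (size γ c)))
  exec c (inj₁ (a , eq , eq′)) rewrite eq | eq′ =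
    relax (s≤s (s≤s (≤-trans (⟪⟫-mono (time F) (n≤1+n _)) (m≤m+n _ _))))
      (branch refl (pop refl ⨾ correct F a))
  exec c (inj₂ (b , eq , eq′)) rewrite eq | eq′ =
    relax (s≤s (s≤s (≤-trans (⟪⟫-mono (time G) (n≤1+n _)) (m≤n+m _ _))))
      (branch refl (pop refl ⨾ correct G b))
  bound : ∀ c → Case c → size δ (h c) ≤ ⟪ space F ⟫ (size γ c) + ⟪ space G ⟫ (size γ c)
  bound c (inj₁ (a , eq , eq′)) rewrite eq | eq′ =
    ≤-trans (small F a) (≤-trans (⟪⟫-mono (space F) (n≤1+n _)) (m≤m+n _ _))
  bound c (inj₂ (b , eq , eq′)) rewrite eq | eq′ =
    ≤-trans (small G b) (≤-trans (⟪⟫-mono (space G) (n≤1+n _)) (m≤n+m _ _))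

ifᶜ_then_else_ : ∀ {c : ⟦ α ⟧ → Bool} {f g : ⟦ α ⟧ → ⟦ β ⟧} →
                 Computable α `Bool c → Computable α β f → Computable α β g →
                 Computable α β (λ a → if c a then f a else g a)
ifᶜ_then_else_ {f = f} {g} C F G =
  branchᶜ (λ (b , a) → if b then f a else g a) F G
    (λ where (true  , a) → inj₁ (a , refl , refl)
             (false , a) → inj₂ (a , refl , refl))
  ∘ᶜ ⟨ C , idᶜ ⟩

caseList : ∀ {X Y : Set} → Y → (X → List X → Y) → List X → Y
caseList n c []       = n
caseList n c (x ∷ xs) = c x xs

caseᶜ : ∀ {l : ⟦ α ⟧ → List ⟦ β ⟧} {n : ⟦ α ⟧ → ⟦ γ ⟧} {c : ⟦ β `× `List β `× α ⟧ → ⟦ γ ⟧} →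
        Computable α (`List β) l → Computable α γ n → Computable (β `× `List β `× α) γ c →
        Computable α γ (λ a → caseList (n a) (λ x xs → c (x , xs , a)) (l a))
caseᶜ {α} {β} {n = n} {c} L N C =
  branchᶜ (λ (l , a) → caseList (n a) (λ x xs → c (x , xs , a)) l) C N
    (λ where ([]     , a) → inj₂ (a , refl , refl)
             (x ∷ xs , a) → inj₁ ((x , xs , a) ,
                cong (`1 ∷_) (++-assoc (enc β x) (enc (`List β) xs) (enc α a)) , refl))
  ∘ᶜ ⟨ L , idᶜ ⟩

testᶜ : (b : Symbol → Bool) → Computable `Symbol `Bool b
testᶜ b = record
  { program = branch M isOne (replace `1) (branch M isZero (replace `0) (replace #))
  ; time    = con 5 ; space = con 1
  ; correct = λ where
      `1 → relax (n≤1+n 4) (branch refl (pop refl ⨾ push refl))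
      `0 → branch refl (branch refl (pop refl ⨾ push refl))
      #  → branch refl (branch refl (pop refl ⨾ push refl))
  ; small   = λ _ → ≤-refl
  }
  where
  replace : Symbol → Program 3
  replace s = pop M ⨾ push M (bit (b s))

-- One step of a fold in numbers: `s` is the size of the first entry, `l` of the remaining list, `u`
-- of the accumulator, `v` of the parameter, `q` the growth allowed now and `k` the growth allowed
-- later. The step moves `q` from the reserve into the accumulator, so the bound `w` persists.
step-≤ : ∀ {n w} s l u v q k → suc (s + l) + v ≤ n → suc (s + l) + (u + v) + (q + k) ≤ w →
         l + v ≤ n × s + (l + (u + v)) ≤ w × s + v ≤ n × l + (u + q + v) + k ≤ w
step-≤ s l u v q k le le′ =
  ≤-trans (+-monoˡ-≤ v (≤-trans (m≤n+m l s) (n≤1+n (s + l)))) le ,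
  ≤-trans (≤-reflexive (sym (+-assoc s l (u + v)))) (≤-trans (n≤1+n _) (≤-trans (m≤m+n _ (q + k)) le′)) ,
  ≤-trans (+-monoˡ-≤ v (≤-trans (m≤m+n s l) (n≤1+n (s + l)))) le ,
  ≤-trans (m≤n+m _ (suc s)) (≤-trans (≤-reflexive
    (solve 6 (λ s l u v q k → con 1 :+ s :+ (l :+ (u :+ q :+ v) :+ k)
                         := con 1 :+ (s :+ l) :+ (u :+ v) :+ (q :+ k)) refl s l u v q k)) le′)
  where open +-*-Solver

-- Additive growth is what keeps iteration polynomial: the accumulator exceeds its
-- initial value by at most the length of the list times a bound independent of it.
module Fold {τ σ α} {g : ⟦ τ `× σ `× α ⟧ → ⟦ σ ⟧} (q : Polynomial)
            (growth : ∀ x y a → size σ (g (x , y , a)) ≤ size σ y + ⟪ q ⟫ (size τ x + size α a))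
            (advance : Computable (τ `× `List τ `× σ `× α) (`List τ `× σ `× α)
                         (λ (x , xs , y , a) → xs , g (x , y , a) , a)) where

  fold : ⟦ `List τ `× σ `× α ⟧ → ⟦ σ `× α ⟧
  fold (xs , y , a) = foldl (λ y x → g (x , y , a)) y xs , a

  body : Program 3
  body = while M isOne (pop M ⨾ program advance)

  grow : Polynomial
  grow = X ⊕ X ⊗ q

  size-state : ∀ xs y a → size (`List τ `× σ `× α) (xs , y , a) ≡
                          size (`List τ) xs + (size σ y + size α a)
  size-state xs y a = trans (size-× (`List τ) (σ `× α) xs (y , a)) (cong (_ +_) (size-× σ α y a))

  module _ (n : ℕ) (a : ⟦ α ⟧) where
    Q : ℕ
    Q = ⟪ q ⟫ n

    step-size : ∀ {w} x xs y → size (`List τ) (x ∷ xs) + size α a ≤ n →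
                size (`List τ) (x ∷ xs) + (size σ y + size α a) + length (x ∷ xs) * Q ≤ w →
                size (`List τ) xs + size α a ≤ n ×
                size τ x + (size (`List τ) xs + (size σ y + size α a)) ≤ w ×
                size (`List τ) xs + (size σ (g (x , y , a)) + size α a) + length xs * Q ≤ w
    step-size x xs y le le′ rewrite length-++ (enc τ x) {enc* τ xs}
      with le₁ , le₂ , le₃ , le₄ ← 
        step-≤ (size τ x) (size (`List τ) xs) (size σ y) (size α a) Q (length xs * Q) le le′ =
      le₁ , le₂ ,
      ≤-trans (+-monoˡ-≤ (length xs * Q) (+-monoʳ-≤ (size (`List τ) xs) (+-monoˡ-≤ (size α a)
        (≤-trans (growth x y a) (+-monoʳ-≤ (size σ y) (⟪⟫-mono q le₃)))))) le₄

    -- The bound `w` acts as a potential: size of the state plus `Q` for each remaining entry. It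
    -- serves every iteration, as does `n`, which bounds the list and the parameter but not the
    -- accumulator and so keeps `Q` fixed.
    body-exec : ∀ w xs y {m} → size (`List τ) xs + size α a ≤ n →
      size (`List τ) xs + (size σ y + size α a) + length xs * Q ≤ w →
      Exec body (stacks (enc _ (xs , y , a) ++ m) [] [])
                (stacks (`0 ∷ enc _ (fold (xs , y , a)) ++ m) [] [])
                (length xs * (2 + ⟪ time advance ⟫ w) + 1)
    body-exec w []       y le le′ = stop refl refl
    body-exec w (x ∷ xs) y {m} le le′ with step-size x xs y le le′
    ... | le₁ , le₂ , le₃ =
      relax (≤-reflexive (cong suc (sym (cong suc (+-assoc (⟪ time advance ⟫ w) _ 1)))))
        (loop refl refl
          (pop refl ⨾
           relax (⟪⟫-mono (time advance) (≤-trans (≤-reflexive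
              (trans (size-× τ (`List τ `× σ `× α) x (xs , y , a))
                     (cong (size τ x +_) (size-state xs y a)))) le₂))
             (cast (cong (λ z → stacks (z ++ m) [] [])
                         (sym (++-assoc (enc τ x) (enc (`List τ) xs) (enc (σ `× α) (y , a))))) refl
                   (correct advance (x , xs , y , a))))
          (body-exec w xs (g (x , y , a)) le₁ le₃))

    fold-size : ∀ w xs y → size (`List τ) xs + size α a ≤ n →
      size (`List τ) xs + (size σ y + size α a) + length xs * Q ≤ w →
      size (σ `× α) (fold (xs , y , a)) ≤ w
    fold-size w []       y le le′ =
      ≤-trans (≤-reflexive (size-× σ α y a)) (≤-trans (n≤1+n _) (≤-trans (m≤m+n _ _) le′))
    fold-size w (x ∷ xs) y le le′ with step-size x xs y le le′
    ... | le₁ , le₂ , le₃ = fold-size w xs (g (x , y , a)) le₁ le₃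

  foldCore : Computable (`List τ `× σ `× α) (σ `× α) fold
  foldCore = record
    -- The pop removes the end tag of the exhausted list.
    { program = body ⨾ pop M
    ; time    = X ⊗ (con 2 ⊕ time advance ⊚ grow) ⊕ con 1 ⊕ con 1
    ; space   = grow
    ; correct = λ (xs , y , a) → relax (+-monoˡ-≤ 1 (+-monoˡ-≤ 1 (*-monoˡ-≤ _ (length-≤ xs y a))))
                  (body-exec _ a _ xs y (part-≤ xs y a) (total-≤ xs y a) ⨾ pop refl)
    ; small   = λ (xs , y , a) → fold-size _ a _ xs y (part-≤ xs y a) (total-≤ xs y a)
    }
    where
    module _ (xs : List ⟦ τ ⟧) (y : ⟦ σ ⟧) (a : ⟦ α ⟧) where
      N = size (`List τ `× σ `× α) (xs , y , a)

      length-≤ : length xs ≤ N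
      length-≤ = ≤-trans (length≤size τ xs)
        (≤-trans (m≤m+n _ _) (≤-reflexive (sym (size-× (`List τ) (σ `× α) xs (y , a)))))

      part-≤ : size (`List τ) xs + size α a ≤ N
      part-≤ = ≤-trans (+-monoʳ-≤ (size (`List τ) xs) (m≤n+m _ _)) (≤-reflexive (sym (size-state xs y a)))

      total-≤ : size (`List τ) xs + (size σ y + size α a) + length xs * ⟪ q ⟫ N ≤ ⟪ grow ⟫ N
      total-≤ = +-mono-≤ (≤-reflexive (sym (size-state xs y a))) (*-monoˡ-≤ _ length-≤)

foldᶜ : ∀ {g : ⟦ β `× γ `× α ⟧ → ⟦ γ ⟧} {l : ⟦ α ⟧ → List ⟦ β ⟧} {i : ⟦ α ⟧ → ⟦ γ ⟧} →
        Computable (β `× γ `× α) γ g → (q : Polynomial) →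
        (∀ x y a → size γ (g (x , y , a)) ≤ size γ y + ⟪ q ⟫ (size β x + size α a)) →
        Computable α (`List β) l → Computable α γ i →
        Computable α γ (λ a → foldl (λ y x → g (x , y , a)) (i a) (l a))
foldᶜ {β} {γ} {α} {g} G q growth L I = fstᶜ ∘ᶜ Fold.foldCore q growth advance ∘ᶜ ⟨ L , ⟨ I , idᶜ ⟩ ⟩
  where
  advance : Computable (β `× `List β `× γ `× α) (`List β `× γ `× α)
              (λ (x , xs , y , a) → xs , g (x , y , a) , a)
  advance = ⟨ fstᶜ ∘ᶜ sndᶜ , ⟨ G ∘ᶜ ⟨ fstᶜ , sndᶜ ∘ᶜ sndᶜ ⟩ , sndᶜ ∘ᶜ sndᶜ ∘ᶜ sndᶜ ⟩ ⟩

-- List functions obtained from folds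

size-ʳ++-≤ : ∀ α xs ys → size (`List α) (xs ʳ++ ys) ≤ size (`List α) xs + size (`List α) ys
size-ʳ++-≤ α []       ys = n≤1+n _
size-ʳ++-≤ α (x ∷ xs) ys = ≤-trans (size-ʳ++-≤ α xs (x ∷ ys)) (≤-reflexive
  (trans (cong (size (`List α) xs +_) (size-∷ α x ys))
  (trans (solve 3 (λ n l m → l :+ (con 1 :+ (n :+ m)) := con 1 :+ (n :+ l) :+ m) refl
           (size α x) (size (`List α) xs) (size (`List α) ys))
         (cong (_+ size (`List α) ys) (sym (size-∷ α x xs))))))
  where open +-*-Solver

_ʳ++ᶜ_ : ∀ {f g : ⟦ α ⟧ → List ⟦ β ⟧} → Computable α (`List β) f → Computable α (`List β) g →
         Computable α (`List β) (λ a → f a ʳ++ g a)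
_ʳ++ᶜ_ {α} {β} F G = foldᶜ (consᶜ fstᶜ (fstᶜ ∘ᶜ sndᶜ)) (con 1 ⊕ X)
  (λ x y a → ≤-trans (≤-reflexive (trans (size-∷ β x y) (+-comm (suc (size β x)) _)))
                     (+-monoʳ-≤ (size (`List β) y) (s≤s (m≤m+n (size β x) (size α a)))))
  F G

reverseᶜ : ∀ {f : ⟦ α ⟧ → List ⟦ β ⟧} → Computable α (`List β) f → Computable α (`List β) (reverse ∘ f)
reverseᶜ F = F ʳ++ᶜ nilᶜ

foldrᶜ : ∀ {g : ⟦ β `× γ `× α ⟧ → ⟦ γ ⟧} {l : ⟦ α ⟧ → List ⟦ β ⟧} {i : ⟦ α ⟧ → ⟦ γ ⟧} →
         Computable (β `× γ `× α) γ g → (q : Polynomial) →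
         (∀ x y a → size γ (g (x , y , a)) ≤ size γ y + ⟪ q ⟫ (size β x + size α a)) →
         Computable α (`List β) l → Computable α γ i →
         Computable α γ (λ a → foldr (λ x y → g (x , y , a)) (i a) (l a))
foldrᶜ {g = g} {l} {i} G q growth L I =
  foldᶜ G q growth (reverseᶜ L) I ≗ᶜ (λ a → reverse-foldl (λ y x → g (x , y , a)) (i a) (l a))

-- Appending is expressed by two reversals, because `_ʳ++_` is directly a left fold of `_∷_`.
concatMap-foldr : ∀ {X Y : Set} (f : X → List Y) xs →
                  foldr (λ x ys → reverse (f x) ʳ++ ys) [] xs ≡ concatMap f xs
concatMap-foldr f []       = refl
concatMap-foldr f (x ∷ xs) = trans (ʳ++-ʳ++ (f x)) (cong (f x ++_) (concatMap-foldr f xs))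

concatMapᶜ : ∀ {f : ⟦ β `× α ⟧ → List ⟦ γ ⟧} {l : ⟦ α ⟧ → List ⟦ β ⟧} →
             Computable (β `× α) (`List γ) f → Computable α (`List β) l →
             Computable α (`List γ) (λ a → concatMap (λ x → f (x , a)) (l a))
concatMapᶜ {β} {α} {γ} {f} {l} F L =
  foldrᶜ (reverseᶜ (F ∘ᶜ ⟨ fstᶜ , sndᶜ ∘ᶜ sndᶜ ⟩) ʳ++ᶜ (fstᶜ ∘ᶜ sndᶜ)) (space F ⊕ con 1) growth L nilᶜ
  ≗ᶜ (λ a → concatMap-foldr (λ x → f (x , a)) (l a))
  where
  growth : ∀ x y a → size (`List γ) (reverse (f (x , a)) ʳ++ y) ≤
                     size (`List γ) y + (⟪ space F ⟫ (size β x + size α a) + 1)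
  growth x y a = begin
    size (`List γ) (reverse (f (x , a)) ʳ++ y)          ≤⟨ size-ʳ++-≤ γ (reverse (f (x , a))) y ⟩
    size (`List γ) (reverse (f (x , a))) + size (`List γ) y
      ≤⟨ +-monoˡ-≤ (size (`List γ) y) (size-ʳ++-≤ γ (f (x , a)) []) ⟩
    size (`List γ) (f (x , a)) + 1 + size (`List γ) y
      ≤⟨ +-monoˡ-≤ (size (`List γ) y) (+-monoˡ-≤ 1 (small F (x , a))) ⟩
    ⟪ space F ⟫ (size (β `× α) (x , a)) + 1 + size (`List γ) y
      ≡⟨ cong (λ n → ⟪ space F ⟫ n + 1 + size (`List γ) y) (size-× β α x a) ⟩
    ⟪ space F ⟫ (size β x + size α a) + 1 + size (`List γ) y
      ≡⟨ +-comm _ (size (`List γ) y) ⟩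
    size (`List γ) y + (⟪ space F ⟫ (size β x + size α a) + 1) ∎
    where open ≤-Reasoning

concatMap-singleton : ∀ {X Y : Set} (f : X → Y) xs → concatMap (λ x → [ f x ]) xs ≡ map f xs
concatMap-singleton f []       = refl
concatMap-singleton f (x ∷ xs) = cong (f x ∷_) (concatMap-singleton f xs)

mapᶜ : ∀ {f : ⟦ β `× α ⟧ → ⟦ γ ⟧} {l : ⟦ α ⟧ → List ⟦ β ⟧} →
       Computable (β `× α) γ f → Computable α (`List β) l →
       Computable α (`List γ) (λ a → map (λ x → f (x , a)) (l a))
mapᶜ {f = f} {l} F L =
  concatMapᶜ (consᶜ F nilᶜ) L ≗ᶜ (λ a → concatMap-singleton (λ x → f (x , a)) (l a))

concatMap-filterᵇ : ∀ {X : Set} (p : X → Bool) xs →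
                    concatMap (λ x → if p x then [ x ] else []) xs ≡ filterᵇ p xs
concatMap-filterᵇ p []       = refl
concatMap-filterᵇ p (x ∷ xs) with p x
... | true  = cong (x ∷_) (concatMap-filterᵇ p xs)
... | false = concatMap-filterᵇ p xs

filterᶜ : ∀ {p : ⟦ β `× α ⟧ → Bool} {l : ⟦ α ⟧ → List ⟦ β ⟧} →
          Computable (β `× α) `Bool p → Computable α (`List β) l →
          Computable α (`List β) (λ a → filterᵇ (λ x → p (x , a)) (l a))
filterᶜ {p = p} {l} P L =
  concatMapᶜ (ifᶜ P then consᶜ fstᶜ nilᶜ else nilᶜ) L
  ≗ᶜ (λ a → concatMap-filterᵇ (λ x → p (x , a)) (l a))

_∧ᶜ_ : ∀ {p q : ⟦ α ⟧ → Bool} → Computable α `Bool p → Computable α `Bool q →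
       Computable α `Bool (λ a → p a ∧ q a)
_∧ᶜ_ {p = p} {q} P Q = (ifᶜ P then Q else boolᶜ false) ≗ᶜ λ a → lemma (p a) (q a)
  where
  lemma : ∀ b c → (if b then c else false) ≡ b ∧ c
  lemma true  c = refl
  lemma false c = refl

_∨ᶜ_ : ∀ {p q : ⟦ α ⟧ → Bool} → Computable α `Bool p → Computable α `Bool q →
       Computable α `Bool (λ a → p a ∨ q a)
_∨ᶜ_ {p = p} {q} P Q = (ifᶜ P then boolᶜ true else Q) ≗ᶜ λ a → lemma (p a) (q a)
  where
  lemma : ∀ b c → (if b then true else c) ≡ b ∨ c
  lemma true  c = refl
  lemma false c = refl

anyᶜ : ∀ {p : ⟦ β `× α ⟧ → Bool} {l : ⟦ α ⟧ → List ⟦ β ⟧} →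
       Computable (β `× α) `Bool p → Computable α (`List β) l →
       Computable α `Bool (λ a → any (λ x → p (x , a)) (l a))
anyᶜ {p = p} {l} P L =
  foldrᶜ ((P ∘ᶜ ⟨ fstᶜ , sndᶜ ∘ᶜ sndᶜ ⟩) ∨ᶜ (fstᶜ ∘ᶜ sndᶜ)) (con 0) (λ _ _ _ → ≤-refl) L (boolᶜ false)
  ≗ᶜ (λ a → lemma (λ x → p (x , a)) (l a))
  where
  lemma : ∀ {X : Set} (p : X → Bool) xs → foldr (λ x b → p x ∨ b) false xs ≡ any p xs
  lemma p []       = refl
  lemma p (x ∷ xs) = cong (p x ∨_) (lemma p xs)

allᶜ : ∀ {p : ⟦ β `× α ⟧ → Bool} {l : ⟦ α ⟧ → List ⟦ β ⟧} →
       Computable (β `× α) `Bool p → Computable α (`List β) l →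
       Computable α `Bool (λ a → all (λ x → p (x , a)) (l a))
allᶜ {p = p} {l} P L =
  foldrᶜ ((P ∘ᶜ ⟨ fstᶜ , sndᶜ ∘ᶜ sndᶜ ⟩) ∧ᶜ (fstᶜ ∘ᶜ sndᶜ)) (con 0) (λ _ _ _ → ≤-refl) L (boolᶜ true)
  ≗ᶜ (λ a → lemma (λ x → p (x , a)) (l a))
  where
  lemma : ∀ {X : Set} (p : X → Bool) xs → foldr (λ x b → p x ∧ b) true xs ≡ all p xs
  lemma p []       = refl
  lemma p (x ∷ xs) = cong (p x ∧_) (lemma p xs)

iterate : {X : Set} → (X → X) → ℕ → X → X
iterate f zero    = id
iterate f (suc n) = iterate f n ∘ f

-- A fold would demand additive growth, but a round such as `expand` can multiply the size of its
-- argument. Composition has no such restriction, at the price of a polynomial that depends on `n`.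
iterateᶜ : ∀ {f : ⟦ α ⟧ → ⟦ α ⟧} → Computable α α f → ∀ n → Computable α α (iterate f n)
iterateᶜ F zero    = idᶜ
iterateᶜ F (suc n) = iterateᶜ F n ∘ᶜ F

tail : {X : Set} → List X → List X
tail = caseList [] (λ _ xs → xs)

tailᶜ : Computable (`List α) (`List α) tail
tailᶜ = caseᶜ idᶜ nilᶜ (fstᶜ ∘ᶜ sndᶜ)

size-tail : ∀ α xs → size (`List α) (tail xs) ≤ size (`List α) xs
size-tail α []       = ≤-refl
size-tail α (x ∷ xs) = ≤-trans (m≤n+m _ (suc (size α x))) (≤-reflexive (sym (size-∷ α x xs)))

nullᶜ : Computable (`List α) `Bool null
nullᶜ = caseᶜ idᶜ (boolᶜ true) (boolᶜ false) ≗ᶜ λ where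
  []      → refl
  (_ ∷ _) → refl

infixl 6 _⊖_

-- Truncated subtraction, when lists are read as unary numbers.
_⊖_ : {X Y : Set} → List X → List Y → List X
xs ⊖ ys = foldl (λ xs _ → tail xs) xs ys

⊖ᶜ : Computable (`List α `× `List β) (`List α) (uncurry _⊖_)
⊖ᶜ {α} = foldᶜ (tailᶜ ∘ᶜ fstᶜ ∘ᶜ sndᶜ) (con 0)
  (λ _ xs _ → ≤-trans (size-tail α xs) (m≤m+n _ 0)) sndᶜ fstᶜ

size-⊖ : ∀ α {Y : Set} xs (ys : List Y) → size (`List α) (xs ⊖ ys) ≤ size (`List α) xs
size-⊖ α xs []       = ≤-refl
size-⊖ α xs (_ ∷ ys) = ≤-trans (size-⊖ α (tail xs) ys) (size-tail α xs)

-- From computable functions to polynomial-time machines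

load : Program 3
load = transfer M A ⨾ push M `0 ⨾ while A is-just (xfer A M ⨾ push M `1)

-- The input carries no tags and ends at a blank, so its list code is built from the last symbol
-- upwards; hence the detour through `A`. Each symbol costs 6 steps on the way there and 8 on the
-- way back, where it receives its tag.
load-exec : ∀ w → Exec load (stacks w [] []) (stacks (enc (`List `Symbol) w ++ []) [] []) 
                                (14 * length w + 4)
load-exec w = relax cost (transfer-exec M→A w ⨾ push refl ⨾
  cast refl (cong (λ v → stacks v [] []) (trans (cong (enc (`List `Symbol)) (ʳ++-ʳ++ w)) (sym ends)))
       (unload (w ʳ++ []) []))
  where
  ends : enc (`List `Symbol) w ++ [] ≡ enc (`List `Symbol) (w ++ [])
  ends = trans (++-identityʳ _) (cong (enc (`List `Symbol)) (sym (++-identityʳ w)))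
  unload : ∀ x v → Exec (while A is-just (xfer A M ⨾ push M `1))
    (stacks (enc (`List `Symbol) v) x []) (stacks (enc (`List `Symbol) (x ʳ++ v)) [] [])
    (8 * length x + 1)
  unload []      v = stop refl refl
  unload (s ∷ x) v = relax (≤-reflexive (cong (_+ 1) (sym (*-suc 8 (length x)))))
    (loop refl refl (xfer-exec A→M s ⨾ push refl) (unload x (s ∷ v)))
  cost : 6 * length w + 1 + (2 + (8 * length (w ʳ++ []) + 1)) ≤ 14 * length w + 4
  cost = ≤-reflexive (trans
    (cong (λ n → 6 * length w + 1 + (2 + (8 * n + 1))) (trans (length-ʳ++ w) (+-identityʳ (length w))))
    (solve 1 (λ n → con 6 :* n :+ con 1 :+ (con 2 :+ (con 8 :* n :+ con 1)) := con 14 :* n :+ con 4)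
      refl (length w)))
    where
    open import Data.Nat.Solver using (module +-*-Solver)
    open +-*-Solver

size-symbols : ∀ w → size (`List `Symbol) w ≡ 2 * length w + 1
size-symbols []      = refl
size-symbols (_ ∷ w) = trans (cong (2 +_) (size-symbols w)) (cong (_+ 1) (sym (*-suc 2 (length w))))

polynomialBound : ∀ P N p → let open DecisionProblem P in
  (∀ x → ∃[ t ] t ≤ ⟪ p ⟫ (length (encode x)) ×
         ((Yes x × outcome N t (encode x) ≡ accept) ⊎ (¬ Yes x × outcome N t (encode x) ≡ reject))) →
  PolynomialTime P
polynomialBound P N p decides with ⟪⟫-bound p
... | c , e , bound = N , c , e , λ x →
  let t , t≤ , verdict = decides x in t , ≤-trans t≤ (bound (length (encode x))) , verdict
  where open DecisionProblem P

computable⇒polynomialTime : ∀ P {f} → Computable (`List `Symbol) `Bool f →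
  let open DecisionProblem P in
  (∀ x → T (f (encode x)) → Yes x) → (∀ x → Yes x → T (f (encode x))) → PolynomialTime P
computable⇒polynomialTime P {f} F sound complete =
  -- The summands are the verdict, the loading of the input, and `F` on a list code of size
  -- `2 * length w + 1`: two symbols per input symbol and the end tag.
  polynomialBound P (machine decider) (con 1 ⊕ (con 14 ⊗ X ⊕ con 4 ⊕ time F ⊚ (con 2 ⊗ X ⊕ con 1)))
    λ x → let t , t≤ , eq = decides (exec (encode x)) in t , t≤ , verdict x t eq
  where
  open DecisionProblem P

  decider : Program 3
  decider = load ⨾ program F

  exec : ∀ w → Exec decider (stacks w [] []) (stacks (bit (f w) ∷ []) [] [])
                    (14 * length w + 4 + ⟪ time F ⟫ (2 * length w + 1))
  exec w = load-exec w ⨾ relax (≤-reflexive (cong ⟪ time F ⟫ (size-symbols w))) (correct F w)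

  verdict : ∀ x t →
            outcome (machine decider) t (encode x) ≡
            (if isOne (just (bit (f (encode x)))) then accept else reject) →
            (Yes x × outcome (machine decider) t (encode x) ≡ accept) ⊎
            (¬ Yes x × outcome (machine decider) t (encode x) ≡ reject)
  verdict x t eq with f (encode x) | sound x | complete x
  ... | true  | s | _ = inj₁ (s tt , eq)
  ... | false | _ | c = inj₂ (c , eq)

-- The decision procedure

-- Vertices have unary names. These are affordable, as the adjacency matrix in the input is already
-- longer than any of them.
`Vertex `Arc `Graph : Type
`Vertex = `List `⊤
`Arc    = `Vertex `× `Vertex
`Graph  = `List `Arc

Vertex Edge Graph : Set
Vertex = ⟦ `Vertex ⟧
Edge   = ⟦ `Arc ⟧
Graph  = ⟦ `Graph ⟧

sameVertex : Vertex × Vertex → Bool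
sameVertex (u , v) = null (u ⊖ v) ∧ null (v ⊖ u)

sameVertexᶜ : Computable (`Vertex `× `Vertex) `Bool sameVertex
sameVertexᶜ = (nullᶜ ∘ᶜ ⊖ᶜ) ∧ᶜ (nullᶜ ∘ᶜ ⊖ᶜ ∘ᶜ swapᶜ)

sameArc : Edge × Edge → Bool
sameArc ((u , v) , (x , y)) = sameVertex (u , x) ∧ sameVertex (v , y)

sameArcᶜ : Computable (`Arc `× `Arc) `Bool sameArc
sameArcᶜ = (sameVertexᶜ ∘ᶜ ⟨ fstᶜ ∘ᶜ fstᶜ , fstᶜ ∘ᶜ sndᶜ ⟩) ∧ᶜ
           (sameVertexᶜ ∘ᶜ ⟨ sndᶜ ∘ᶜ fstᶜ , sndᶜ ∘ᶜ sndᶜ ⟩)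

member : Edge × Graph → Bool
member (e , G) = any (λ a → sameArc (e , a)) G

memberᶜ : Computable (`Arc `× `Graph) `Bool member
memberᶜ = anyᶜ (sameArcᶜ ∘ᶜ ⟨ fstᶜ ∘ᶜ sndᶜ , fstᶜ ⟩) sndᶜ

-- Deleting an arc and inserting its opposite becomes a single pass that swaps matching entries; a
-- loop is left as it is, in agreement with `reverseArc`.
reverseIn : Edge × Graph → Graph
reverseIn (e , G) = map (λ a → if sameArc (e , a) then swap a else a) G

reverseInᶜ : Computable (`Arc `× `Graph) `Graph reverseIn
reverseInᶜ = mapᶜ (ifᶜ sameArcᶜ ∘ᶜ ⟨ fstᶜ ∘ᶜ sndᶜ , fstᶜ ⟩ then swapᶜ ∘ᶜ fstᶜ else fstᶜ) sndᶜ

-- Keeping `G` itself turns "exactly k rounds" into "at most k reversals".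
candidates : Graph → List Graph
candidates G = G ∷ map (λ e → reverseIn (e , G)) G

candidatesᶜ : Computable `Graph (`List `Graph) candidates
candidatesᶜ = consᶜ idᶜ (mapᶜ reverseInᶜ idᶜ)

expand : List Graph → List Graph
expand = concatMap candidates

expandᶜ : Computable (`List `Graph) (`List `Graph) expand
expandᶜ = concatMapᶜ (candidatesᶜ ∘ᶜ fstᶜ) idᶜ

pairs : List Vertex → Graph
pairs V = concatMap (λ u → map (λ v → u , v) V) V

abstract
  -- The space polynomial of pairsᶜ is too large to be unfolded in the bounds below.
  pairsᶜ : Computable (`List `Vertex) `Graph pairs
  pairsᶜ = concatMapᶜ (mapᶜ swapᶜ′ sndᶜ) idᶜ
    where
    swapᶜ′ : Computable (`Vertex `× `Vertex `× `List `Vertex) `Arc (λ (v , u , _) → u , v)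
    swapᶜ′ = ⟨ fstᶜ ∘ᶜ sndᶜ , fstᶜ ⟩

-- Selecting from `pairs V` bounds the size of the result by `V` alone, whatever the relations `R`
-- and `S`. This supplies the growth bound of the fold in `withinᶜ`.
compose : List Vertex × Graph × Graph → Graph
compose (V , R , S) =
  filterᵇ (λ (u , w) → any (λ v → member ((u , v) , R) ∧ member ((v , w) , S)) V) (pairs V)

composeᶜ : Computable (`List `Vertex `× `Graph `× `Graph) `Graph compose
composeᶜ = filterᶜ
  (anyᶜ ((memberᶜ ∘ᶜ ⟨ ⟨ fstᶜ ∘ᶜ fstᶜ ∘ᶜ sndᶜ , fstᶜ ⟩ , fstᶜ ∘ᶜ sndᶜ ∘ᶜ sndᶜ ∘ᶜ sndᶜ ⟩) ∧ᶜ
         (memberᶜ ∘ᶜ ⟨ ⟨ fstᶜ , sndᶜ ∘ᶜ fstᶜ ∘ᶜ sndᶜ ⟩ , sndᶜ ∘ᶜ sndᶜ ∘ᶜ sndᶜ ∘ᶜ sndᶜ ⟩))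
        (fstᶜ ∘ᶜ sndᶜ))
  (pairsᶜ ∘ᶜ fstᶜ)

diagonal : List Vertex → Graph
diagonal V = filterᵇ sameVertex (pairs V)

diagonalᶜ : Computable (`List `Vertex) `Graph diagonal
diagonalᶜ = filterᶜ (sameVertexᶜ ∘ᶜ fstᶜ) pairsᶜ

atMostOne : List Vertex × Graph → Graph
atMostOne (V , G) = filterᵇ (λ e → sameVertex e ∨ member (e , G)) (pairs V)

atMostOneᶜ : Computable (`List `Vertex `× `Graph) `Graph atMostOne
atMostOneᶜ = filterᶜ ((sameVertexᶜ ∘ᶜ fstᶜ) ∨ᶜ (memberᶜ ∘ᶜ ⟨ fstᶜ , sndᶜ ∘ᶜ sndᶜ ⟩)) (pairsᶜ ∘ᶜ fstᶜ)

-- If R is the relation "distance at most c", the result is "distance at most 2c + b".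
horner : Bool × Graph × List Vertex × Graph → Graph
horner (b , R , V , G) =
  if b then compose (V , compose (V , R , R) , atMostOne (V , G)) else compose (V , R , R)

-- The least significant digit comes first, so `foldr` begins at the most significant one, with
-- distance 0.
within : List Bool × List Vertex × Graph → Graph
within (bs , V , G) = foldr (λ b R → horner (b , R , V , G)) (diagonal V) bs

size-filterᵇ : ∀ α p xs → size (`List α) (filterᵇ p xs) ≤ size (`List α) xs
size-filterᵇ α p []       = ≤-refl
size-filterᵇ α p (x ∷ xs) with p x
... | true  = subst₂ _≤_ (sym (size-∷ α x _)) (sym (size-∷ α x xs))
                (s≤s (+-monoʳ-≤ (size α x) (size-filterᵇ α p xs)))
... | false = ≤-trans (size-filterᵇ α p xs)
  (≤-trans (m≤n+m _ (suc (size α x))) (≤-reflexive (sym (size-∷ α x xs))))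

size-compose : ∀ V R S → size `Graph (compose (V , R , S)) ≤ ⟪ space pairsᶜ ⟫ (size (`List `Vertex) V)
size-compose V R S = ≤-trans (size-filterᵇ `Arc _ (pairs V)) (small pairsᶜ V)

size-horner : ∀ b R V G → size `Graph (horner (b , R , V , G)) ≤ ⟪ space pairsᶜ ⟫ (size (`List `Vertex) V)
size-horner true  R V G = size-compose V (compose (V , R , R)) (atMostOne (V , G))
size-horner false R V G = size-compose V R R

hornerᶜ : Computable (`Bool `× `Graph `× `List `Vertex `× `Graph) `Graph horner
hornerᶜ = ifᶜ fstᶜ then composeᶜ ∘ᶜ ⟨ V , ⟨ RR , atMostOneᶜ ∘ᶜ sndᶜ ∘ᶜ sndᶜ ⟩ ⟩ else RR
  where
  V : Computable (`Bool `× `Graph `× `List `Vertex `× `Graph) (`List `Vertex) (λ (_ , _ , V , _) → V)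
  V = fstᶜ ∘ᶜ sndᶜ ∘ᶜ sndᶜ
  RR : Computable (`Bool `× `Graph `× `List `Vertex `× `Graph) `Graph
         (λ (_ , R , V , _) → compose (V , R , R))
  RR = composeᶜ ∘ᶜ ⟨ V , ⟨ fstᶜ ∘ᶜ sndᶜ , fstᶜ ∘ᶜ sndᶜ ⟩ ⟩

withinᶜ : Computable (`List `Bool `× `List `Vertex `× `Graph) `Graph within
withinᶜ = foldrᶜ (hornerᶜ ∘ᶜ ⟨ fstᶜ , ⟨ fstᶜ ∘ᶜ sndᶜ , sndᶜ ∘ᶜ sndᶜ ∘ᶜ sndᶜ ⟩ ⟩) (space pairsᶜ)
  (λ b R (bs , V , G) → ≤-trans (size-horner b R V G) (≤-trans
    (⟪⟫-mono (space pairsᶜ) (size-V b bs V G)) (m≤n+m _ (size `Graph R))))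
  fstᶜ (diagonalᶜ ∘ᶜ fstᶜ ∘ᶜ sndᶜ)
  where
  size-V : ∀ b bs V G → size (`List `Vertex) V ≤
           size `Bool b + size (`List `Bool `× `List `Vertex `× `Graph) (bs , V , G)
  size-V b bs V G = ≤-trans (m≤m+n (size (`List `Vertex) V) (size `Graph G))
    (≤-trans (≤-reflexive (sym (size-× (`List `Vertex) `Graph V G)))
    (≤-trans (m≤n+m _ (size (`List `Bool) bs))
    (≤-trans (≤-reflexive (sym (size-× (`List `Bool) (`List `Vertex `× `Graph) bs (V , G))))
             (m≤n+m _ (size `Bool b)))))

withinDistance : Graph × List Bool × List Vertex → Bool
withinDistance (G , bs , V) = all (λ e → member (e , within (bs , V , G))) (pairs V)

withinDistanceᶜ : Computable (`Graph `× `List `Bool `× `List `Vertex) `Bool withinDistance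
withinDistanceᶜ =
  allᶜ (memberᶜ ∘ᶜ ⟨ fstᶜ , fstᶜ ∘ᶜ sndᶜ ⟩) (pairsᶜ ∘ᶜ sndᶜ)
  ∘ᶜ ⟨ withinᶜ ∘ᶜ ⟨ fstᶜ ∘ᶜ sndᶜ , ⟨ sndᶜ ∘ᶜ sndᶜ , fstᶜ ⟩ ⟩ , sndᶜ ∘ᶜ sndᶜ ⟩

-- Parsing the input word

isSeparator isSet : Symbol → Bool
isSeparator #       = true
isSeparator (bit _) = false
isSet (bit b)       = b
isSet #             = false

-- Read from the right, the separator that terminates a block is met first and opens it; the bits
-- then join the block in front. Bits after the last separator have no block and are dropped.
extend : Symbol → List (List Bool) → List (List Bool)
extend s bs = if isSeparator s then [] ∷ bs else caseList [] (λ b bs → (isSet s ∷ b) ∷ bs) bs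

blocks : List Symbol → List (List Bool)
blocks = foldr extend []

blocksᶜ : Computable (`List `Symbol) (`List (`List `Bool)) blocks
blocksᶜ = foldrᶜ
  (ifᶜ testᶜ isSeparator ∘ᶜ fstᶜ
   then consᶜ nilᶜ (fstᶜ ∘ᶜ sndᶜ)
   else caseᶜ (fstᶜ ∘ᶜ sndᶜ) nilᶜ
     (consᶜ (consᶜ (testᶜ isSet ∘ᶜ fstᶜ ∘ᶜ sndᶜ ∘ᶜ sndᶜ) fstᶜ) (fstᶜ ∘ᶜ sndᶜ)))
  (con 2) (λ s bs _ → growth s bs) idᶜ nilᶜ
  where
  growth : ∀ s bs → size (`List (`List `Bool)) (extend s bs) ≤ size (`List (`List `Bool)) bs + 2
  growth #       bs       = ≤-reflexive (+-comm 2 (size (`List (`List `Bool)) bs))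
  growth (bit x) []       = s≤s z≤n
  growth (bit x) (b ∷ bs) = ≤-reflexive (+-comm 2 (size (`List (`List `Bool)) (b ∷ bs)))

-- The i-th element gets the name drop i us.  A counter would be a simpler name, but
-- its growth depends on the accumulator, whereas us ⊖ ys is never larger than us.
number : {X : Set} → Vertex × List X → List (Vertex × X)
number (us , xs) = foldl (λ ys x → (us ⊖ ys , x) ∷ ys) [] xs

numberᶜ : Computable (`Vertex `× `List α) (`List (`Vertex `× α)) number
numberᶜ {α} = foldᶜ
  (consᶜ ⟨ ⊖ᶜ ∘ᶜ ⟨ fstᶜ ∘ᶜ sndᶜ ∘ᶜ sndᶜ , fstᶜ ∘ᶜ sndᶜ ⟩ , fstᶜ ⟩ (fstᶜ ∘ᶜ sndᶜ))
  (con 1 ⊕ X) (λ x ys (us , xs) → growth x ys us xs) sndᶜ nilᶜ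
  where
  growth : ∀ x ys us xs → size (`List (`Vertex `× α)) ((us ⊖ ys , x) ∷ ys) ≤
           size (`List (`Vertex `× α)) ys + (1 + (size α x + size (`Vertex `× `List α) (us , xs)))
  growth x ys us xs = begin
    size (`List (`Vertex `× α)) ((us ⊖ ys , x) ∷ ys)
      ≡⟨ trans (size-∷ (`Vertex `× α) (us ⊖ ys , x) ys)
               (cong (λ n → suc (n + s)) (size-× `Vertex α (us ⊖ ys) x)) ⟩
    suc (size `Vertex (us ⊖ ys) + size α x + s)
      ≤⟨ s≤s (+-monoˡ-≤ s (+-monoˡ-≤ (size α x) (≤-trans (size-⊖ `⊤ us ys) (m≤m+n u v)))) ⟩
    suc (u + v + size α x + s)
      ≡⟨ solve 3 (λ n m s → con 1 :+ (n :+ m :+ s) := s :+ (con 1 :+ (m :+ n))) refl (u + v) (size α x) s ⟩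
    s + (1 + (size α x + (u + v)))
      ≡⟨ cong (λ n → s + (1 + (size α x + n))) (size-× `Vertex (`List α) us xs) ⟨
    s + (1 + (size α x + size (`Vertex `× `List α) (us , xs))) ∎
    where
    open ≤-Reasoning
    open +-*-Solver
    s = size (`List (`Vertex `× α)) ys
    u = size `Vertex us
    v = size (`List α) xs

vertexList : List (List Bool) → List Vertex
vertexList rows = map proj₁ (number (map (const tt) rows , rows))

-- Columns are numbered with the units of `rows` rather than those of the row itself, so that row
-- and column of a vertex receive the same name from the same supply.
arcList : List (List Bool) → Graph
arcList rows =
  concatMap (λ (u , row) →
    concatMap (λ (v , b) → if b then [ (u , v) ] else []) (number (map (const tt) rows , row)))
  (number (map (const tt) rows , rows))

numberedᶜ : Computable (`List α) (`List (`Vertex `× α)) (λ xs → number (map (const tt) xs , xs))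
numberedᶜ = numberᶜ ∘ᶜ ⟨ mapᶜ unitᶜ idᶜ , idᶜ ⟩

vertexListᶜ : Computable (`List (`List `Bool)) (`List `Vertex) vertexList
vertexListᶜ = mapᶜ (fstᶜ ∘ᶜ fstᶜ) numberedᶜ

arcListᶜ : Computable (`List (`List `Bool)) `Graph arcList
arcListᶜ = concatMapᶜ
  (concatMapᶜ (ifᶜ sndᶜ ∘ᶜ fstᶜ then consᶜ ⟨ fstᶜ ∘ᶜ fstᶜ ∘ᶜ sndᶜ , fstᶜ ∘ᶜ fstᶜ ⟩ nilᶜ else nilᶜ)
    (numberᶜ ∘ᶜ ⟨ mapᶜ unitᶜ sndᶜ , sndᶜ ∘ᶜ fstᶜ ⟩))
  numberedᶜ

decideRows : ℕ → List Bool → List (List Bool) → Bool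
decideRows k bs rows =
  any (λ G → withinDistance (G , bs , vertexList rows)) (iterate expand k [ arcList rows ])

-- The first block is the target and the others are the matrix. The default `false` concerns words
-- without separator, which are not encodings.
decide : ℕ → List Symbol → Bool
decide k w = caseList false (decideRows k) (blocks w)

decideᶜ : ∀ k → Computable (`List `Symbol) `Bool (decide k)
decideᶜ k = caseᶜ blocksᶜ (boolᶜ false)
  (anyᶜ (withinDistanceᶜ ∘ᶜ ⟨ fstᶜ , ⟨ fstᶜ ∘ᶜ sndᶜ , vertexListᶜ ∘ᶜ fstᶜ ∘ᶜ sndᶜ ∘ᶜ sndᶜ ⟩ ⟩)
        (iterateᶜ expandᶜ k ∘ᶜ consᶜ (arcListᶜ ∘ᶜ fstᶜ ∘ᶜ sndᶜ) nilᶜ))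

-- Distances and diameters

module _ {n : ℕ} where

  Reach : Digraph n → ℕ → Fin n → Fin n → Set
  Reach D c u v = Σ[ w ∈ Walk D u v ] walkLength w ≤ c

  module _ {D : Digraph n} where

    walkLength-◅◅ : ∀ {u v w} (p : Walk D u v) (q : Walk D v w) →
                    walkLength (p ◅◅ q) ≡ walkLength p + walkLength q
    walkLength-◅◅ ε       q = refl
    walkLength-◅◅ (_ ◅ p) q = cong suc (walkLength-◅◅ p q)

    reach-concat : ∀ {c d u v w} → Reach D c u v → Reach D d v w → Reach D (c + d) u w
    reach-concat (p , p≤) (q , q≤) =
      p ◅◅ q , ≤-trans (≤-reflexive (walkLength-◅◅ p q)) (+-mono-≤ p≤ q≤)

    -- A walk that ends within the first `c` arcs is split at its end: `Reach` bounds lengths from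
    -- above, so a piece may be shorter than its share.
    reach-split : ∀ c {d u w} → Reach D (c + d) u w → ∃[ v ] Reach D c u v × Reach D d v w
    reach-split zero    r           = _ , (ε , z≤n) , r
    reach-split (suc c) (ε , _)     = _ , (ε , z≤n) , (ε , z≤n)
    reach-split (suc c) (a ◅ p , s≤s p≤) with reach-split c (p , p≤)
    ... | v , (q , q≤) , r = v , (a ◅ q , s≤s q≤) , r

    reach? : ∀ c u v → Dec (Reach D c u v)
    reach? zero    u v = map′ (λ where refl → ε , z≤n) (λ where (ε , _) → refl) (u ≟ v)
    reach? (suc c) u v = map′ glue split
      (u ≟ v ⊎-dec any? (λ w → T? (D u w) ×-dec reach? c w v))
      where
      glue : u ≡ v ⊎ (∃[ w ] Arc D u w × Reach D c w v) → Reach D (suc c) u v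
      glue (inj₁ refl)            = ε , z≤n
      glue (inj₂ (w , a , p , l)) = a ◅ p , s≤s l
      split : Reach D (suc c) u v → u ≡ v ⊎ (∃[ w ] Arc D u w × Reach D c w v)
      split (ε , _)         = inj₁ refl
      split (a ◅ p , s≤s l) = inj₂ (_ , a , p , l)

    suffix : ∀ {u v x} (w : Walk D u v) → Unique (vertices w) → x ∈ vertices w →
             Σ[ p ∈ Path D x v ] pathLength p ≤ walkLength w
    suffix ε       s       (here refl) = record { walk = ε ; simple = s } , z≤n
    suffix (a ◅ w) s       (here refl) = record { walk = a ◅ w ; simple = s } , ≤-refl
    suffix (a ◅ w) (_ ∷ s) (there x∈)  with p , p≤ ← suffix w s x∈ = p , m≤n⇒m≤1+n p≤

    -- If the new first vertex already lies on the path found for the rest, the suffix from that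
    -- occurrence replaces the whole.
    shortcut : ∀ {u v} (w : Walk D u v) → Σ[ p ∈ Path D u v ] pathLength p ≤ walkLength w
    shortcut ε = record { walk = ε ; simple = [] ∷ [] } , z≤n
    shortcut {u} (a ◅ w) with shortcut w
    ... | p , p≤ with mem? _≟_ u (vertices (Path.walk p))
    ...   | yes u∈ with q , q≤ ← suffix (Path.walk p) (Path.simple p) u∈ =
      q , m≤n⇒m≤1+n (≤-trans q≤ p≤)
    ...   | no u∉ = record { walk = a ◅ Path.walk p ; simple = ¬Any⇒All¬ _ u∉ ∷ Path.simple p } , s≤s p≤

    -- The bound is lowered as long as `reach?` allows. Once `c` fails, every walk is longer than
    -- `c`, so one of length at most `suc c` is minimal.
    shortest : ∀ c {u v} → Reach D c u v →
               Σ[ w ∈ Walk D u v ] walkLength w ≤ c × ((q : Walk D u v) → walkLength w ≤ walkLength q)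
    shortest zero    (w , l) = w , l , λ q → ≤-trans l z≤n
    shortest (suc c) {u} {v} (w , l) with reach? c u v
    ... | no ¬r = w , l , λ q → ≤-trans l (≰⇒> λ q≤ → ¬r (q , q≤))
    ... | yes r with w′ , l′ , min ← shortest c r = w′ , m≤n⇒m≤1+n l′ , min

    reach⇒distance : ∀ {c u v} → Reach D c u v → ∃[ l ] l ≤ c × Distance D u v (fin l)
    reach⇒distance {c} r =
      let w , l , min = shortest c r
          p , p≤      = shortcut w
      in pathLength p , ≤-trans p≤ l , finite p (λ q → ≤-trans p≤ (min (Path.walk q)))

    distance-unique : ∀ {u v l m} → Distance D u v l → Distance D u v m → l ≡ m
    distance-unique (finite p min) (finite q min′) = cong fin (≤-antisym (min q) (min′ p))
    distance-unique (finite p min) (infinite ¬p)   = contradiction p ¬p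
    distance-unique (infinite ¬p)  (finite p min)  = contradiction p ¬p
    distance-unique (infinite _)   (infinite _)    = refl

    distance⇒reach : ∀ {u v l} → Distance D u v (fin l) → Reach D l u v
    distance⇒reach (finite p _) = Path.walk p , ≤-refl

    -- `Distance` is a relation, so no distance from `u` to `v` is available beforehand. Without a
    -- short walk there is no path at all, since a path would yield a finite distance below `m`; but
    -- then the distance is `⊤⁺`, which `m ≤⁺ fin d` excludes. Decidability removes the double
    -- negation.
    diameter⇒reach : ∀ {m d} → Diameter D m → m ≤⁺ fin d → ∀ u v → Reach D d u v
    diameter⇒reach {d = d} (_ , bound) m≤d u v = decidable-stable (reach? d u v)
      λ ¬r → ⊤≰ (≤⁺-trans ≤-trans (bound u v (infinite (¬path ¬r))) m≤d)
      where
      ¬path : ¬ Reach D d u v → ¬ Path D u v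
      ¬path ¬r p
        with l , _ , dist ← reach⇒distance (Path.walk p , ≤-refl)
        with w , w≤ ← distance⇒reach dist =
        ¬r (w , ≤-trans w≤ ([≤]-injective (≤⁺-trans ≤-trans (bound u v dist) m≤d)))
      ⊤≰ : ¬ (⊤⁺ ≤⁺ fin d)
      ⊤≰ ()

argmax : ∀ {n} (f : Fin (suc n) → ℕ) → ∃[ i ] ∀ j → f j ≤ f i
argmax {zero}  f = zero , λ where zero → ≤-refl
argmax {suc n} f with argmax (λ i → f (suc i))
... | i , max with ≤-total (f zero) (f (suc i))
...   | inj₁ ≤i = suc i , λ where zero    → ≤i
                                  (suc j) → max j
...   | inj₂ ≥i = zero , λ where zero    → ≤-refl
                                 (suc j) → ≤-trans (max j) ≥i

-- The vertex argument excludes the empty digraph, where no maximum is attained. Otherwise the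
-- diameter is the largest of the eccentricities `len v (far v)`.
reach⇒diameter : ∀ {n d} {D : Digraph n} → Fin n → (∀ u v → Reach D d u v) →
                 ∃[ m ] Diameter D m × m ≤⁺ fin d
reach⇒diameter {suc n} {d} {D} _ r =
  fin (len u (far u)) ,
  ((u , far u , dist u (far u)) , λ v w dvw → subst (_≤⁺ _) (distance-unique (dist v w) dvw)
     ⁺[ ≤-trans (proj₂ (argmax (len v)) w) (proj₂ widest v) ]) ,
  ⁺[ proj₁ (proj₂ (reach⇒distance (r u (far u)))) ]
  where
  len : Fin (suc n) → Fin (suc n) → ℕ
  len v w = proj₁ (reach⇒distance (r v w))
  dist : ∀ v w → Distance D v w (fin (len v w))
  dist v w = proj₂ (proj₂ (reach⇒distance (r v w)))
  far : Fin (suc n) → Fin (suc n)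
  far v = proj₁ (argmax (len v))
  widest = argmax (λ v → len v (far v))
  u = proj₁ widest

-- Correctness of the decision procedure

T-∧⁺ : ∀ {b c} → T b → T c → T (b ∧ c)
T-∧⁺ p q = Equivalence.from T-∧ (p , q)

T-∧⁻ : ∀ {b c} → T (b ∧ c) → T b × T c
T-∧⁻ = Equivalence.to T-∧

T-∨⁺ : ∀ {b c} → T b ⊎ T c → T (b ∨ c)
T-∨⁺ = Equivalence.from T-∨

T-∨⁻ : ∀ {b c} → T (b ∨ c) → T b ⊎ T c
T-∨⁻ = Equivalence.to T-∨

sameVertex-sound : ∀ u v → T (sameVertex (u , v)) → u ≡ v
sameVertex-sound []      []      _ = refl
sameVertex-sound []      (_ ∷ v) t = ⊥-elim (proj₂ (T-∧⁻ {null ([] ⊖ v)} t))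
sameVertex-sound (_ ∷ u) (_ ∷ v) t = cong (tt ∷_) (sameVertex-sound u v t)

sameVertex-refl : ∀ u → T (sameVertex (u , u))
sameVertex-refl []      = tt
sameVertex-refl (_ ∷ u) = sameVertex-refl u

sameArc-sound : ∀ e a → T (sameArc (e , a)) → e ≡ a
sameArc-sound (u , v) (x , y) t with s , s′ ← T-∧⁻ {sameVertex (u , x)} t =
  cong₂ _,_ (sameVertex-sound u x s) (sameVertex-sound v y s′)

sameArc-refl : ∀ e → T (sameArc (e , e))
sameArc-refl (u , v) = T-∧⁺ (sameVertex-refl u) (sameVertex-refl v)

member-sound : ∀ e G → T (member (e , G)) → e ∈ G
member-sound e G t with a , a∈ , s ← find (any⁻ _ G t) = subst (_∈ G) (sym (sameArc-sound e a s)) a∈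

member-complete : ∀ e {G} → e ∈ G → T (member (e , G))
member-complete e e∈ = any⁺ _ (lose e∈ (sameArc-refl e))

∈-filterᵇ⁺ : ∀ {X : Set} (p : X → Bool) {x xs} → x ∈ xs → T (p x) → x ∈ filterᵇ p xs
∈-filterᵇ⁺ p = ∈-filter⁺ (T? ∘ p)

∈-filterᵇ⁻ : ∀ {X : Set} (p : X → Bool) {x} xs → x ∈ filterᵇ p xs → x ∈ xs × T (p x)
∈-filterᵇ⁻ p xs = ∈-filter⁻ (T? ∘ p) {xs = xs}

⊖-drop : ∀ {X Y : Set} (xs : List X) (ys : List Y) → xs ⊖ ys ≡ drop (length ys) xs
⊖-drop xs       []       = refl
⊖-drop []       (_ ∷ ys) = trans (⊖-drop [] ys) (drop-[] (length ys))
⊖-drop (_ ∷ xs) (_ ∷ ys) = ⊖-drop xs ys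

-- Generalised to an accumulator `ys` that is already filled: its length is the index reached so far
-- and shifts all later names.
number⁻ : ∀ {X : Set} {n} (us : Vertex) ys (f : Fin n → X) {p} →
          p ∈ foldl (λ ys x → (us ⊖ ys , x) ∷ ys) ys (tabulate f) →
          p ∈ ys ⊎ (∃[ i ] p ≡ (drop (length ys + toℕ i) us , f i))
number⁻ {n = zero}  us ys f p∈ = inj₁ p∈
number⁻ {n = suc n} us ys f p∈ with number⁻ us _ (f ∘ suc) p∈
... | inj₁ (here refl) = inj₂ (zero , cong (_, f zero)
        (trans (⊖-drop us ys) (cong (λ m → drop m us) (sym (+-identityʳ (length ys))))))
... | inj₁ (there p∈ys) = inj₁ p∈ys
... | inj₂ (i , refl) = inj₂ (suc i , cong (λ m → drop m us , f (suc i)) (sym (+-suc (length ys) (toℕ i))))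

number⁺ : ∀ {X : Set} {n} (us : Vertex) ys (f : Fin n → X) {p} →
          p ∈ ys ⊎ (∃[ i ] p ≡ (drop (length ys + toℕ i) us , f i)) →
          p ∈ foldl (λ ys x → (us ⊖ ys , x) ∷ ys) ys (tabulate f)
number⁺ {n = zero}  us ys f (inj₁ p∈)          = p∈
number⁺ {n = suc n} us ys f (inj₁ p∈)          = number⁺ us _ (f ∘ suc) (inj₁ (there p∈))
number⁺ {n = suc n} us ys f (inj₂ (zero , refl)) = number⁺ us _ (f ∘ suc) (inj₁ (here (cong (_, f zero)
        (trans (cong (λ m → drop m us) (+-identityʳ (length ys))) (sym (⊖-drop us ys))))))
number⁺ {n = suc n} us ys f (inj₂ (suc i , refl)) = number⁺ us _ (f ∘ suc)
  (inj₂ (i , cong (λ m → drop m us , f (suc i)) (+-suc (length ys) (toℕ i))))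

arc-reverseArc⁻ : ∀ {n} {D : Digraph n} {u v x y} → Arc (reverseArc D u v) x y →
                  (Arc D x y × ¬ (x ≡ u × y ≡ v)) ⊎ (x ≡ v × y ≡ u)
arc-reverseArc⁻ {D = D} {u} {v} {x} {y} a with T-∨⁻ {D x y ∧ _} a
arc-reverseArc⁻ {D = D} {u} {v} {x} {y} a | inj₁ b with T-∧⁻ {D x y} b
... | d , ne with x ≟ u | y ≟ v
...   | yes _ | yes _ = ⊥-elim ne
...   | no x≢ | _     = inj₁ (d , x≢ ∘ proj₁)
...   | yes _ | no y≢ = inj₁ (d , y≢ ∘ proj₂)
arc-reverseArc⁻ {D = D} {u} {v} {x} {y} a | inj₂ b with x ≟ v | y ≟ u
...   | yes p | yes q = inj₂ (p , q)
...   | yes _ | no _  = ⊥-elim b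
...   | no _  | _     = ⊥-elim b

arc-reverseArc⁺ : ∀ {n} {D : Digraph n} {u v x y} →
                  (Arc D x y × ¬ (x ≡ u × y ≡ v)) ⊎ (x ≡ v × y ≡ u) → Arc (reverseArc D u v) x y
arc-reverseArc⁺ {D = D} {u} {v} {x} {y} (inj₁ (d , ne)) =
  T-∨⁺ {D x y ∧ _} (inj₁ (T-∧⁺ d distinct))
  where
  distinct : T (not (does (x ≟ u) ∧ does (y ≟ v)))
  distinct with x ≟ u | y ≟ v
  ... | yes p | yes q = ne (p , q)
  ... | yes _ | no _  = tt
  ... | no _  | _     = tt
arc-reverseArc⁺ {D = D} {u} {v} {x} {y} (inj₂ (refl , refl)) = T-∨⁺ {D x y ∧ _} (inj₂ same)
  where
  same : T (does (x ≟ x) ∧ does (y ≟ y))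
  same with x ≟ x | y ≟ y
  ... | yes _ | yes _ = tt
  ... | yes _ | no ¬r = ¬r refl
  ... | no ¬r | _     = ¬r refl

double : ∀ c → c + c ≡ c * 2
double c = trans (cong (c +_) (sym (+-identityʳ c))) (*-comm 2 c)

isOneBit : Bit → Bool
isOneBit zero    = false
isOneBit (suc _) = true

module _ {n : ℕ} where

  name : Fin n → Vertex
  name u = drop (toℕ u) (replicate n tt)

  -- The length of a name is `n ∸ toℕ u`, and truncation loses nothing since `toℕ u ≤ n`.
  name-injective : ∀ {u v} → name u ≡ name v → u ≡ v
  name-injective {u} {v} eq = toℕ-injective
    (∸-cancelˡ-≡ (toℕ≤n u) (toℕ≤n v) (trans (sym (len u)) (trans (cong length eq) (len v))))
    where
    len : ∀ u → length (name u) ≡ n ∸ toℕ u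
    len u = trans (length-drop (toℕ u) (replicate n tt)) (cong (_∸ toℕ u) (length-replicate n))

  arcName : Fin n × Fin n → Edge
  arcName (u , v) = name u , name v

  arcName-injective : ∀ {u v x y} → arcName (u , v) ≡ arcName (x , y) → u ≡ x × v ≡ y
  arcName-injective eq = name-injective (cong proj₁ eq) , name-injective (cong proj₂ eq)

  -- G is compared as a set, since reverseIn can produce repeated arcs.
  record Depicts (G : Graph) (D : Digraph n) : Set where
    field
      arc⁻ : ∀ {e} → e ∈ G → ∃[ u ] ∃[ v ] e ≡ arcName (u , v) × Arc D u v
      arc⁺ : ∀ {u v} → Arc D u v → arcName (u , v) ∈ G

  open Depicts

  reverseIn-depicts : ∀ {G D u v} → Depicts G D → Arc D u v →
                      Depicts (reverseIn (arcName (u , v) , G)) (reverseArc D u v)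
  reverseIn-depicts {G} {D} {u} {v} dep uv = record { arc⁻ = to ; arc⁺ = from }
    where
    f : Edge → Edge
    f a = if sameArc (arcName (u , v) , a) then swap a else a

    to : ∀ {e} → e ∈ map f G → ∃[ x ] ∃[ y ] e ≡ arcName (x , y) × Arc (reverseArc D u v) x y
    to e∈ with a , a∈ , refl ← ∈-map⁻ f e∈ with x , y , refl , xy ← arc⁻ dep a∈
          with sameArc (arcName (u , v) , arcName (x , y)) in eq
    ... | true  = y , x , refl , arc-reverseArc⁺ {D = D}
                    (inj₂ (swap (flip (arcName-injective {u} {v} {x} {y}
                    (sameArc-sound (arcName (u , v)) (arcName (x , y)) (subst T (sym eq) tt))))))
      where
      flip : u ≡ x × v ≡ y → x ≡ u × y ≡ v
      flip (p , q) = sym p , sym q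
    ... | false = x , y , refl , arc-reverseArc⁺ {D = D} (inj₁ (xy , λ where
                    (refl , refl) → subst T eq (sameArc-refl (arcName (u , v)))))

    from : ∀ {x y} → Arc (reverseArc D u v) x y → arcName (x , y) ∈ map f G
    from {x} {y} a with arc-reverseArc⁻ {D = D} a
    ... | inj₁ (xy , ne) = subst (_∈ map f G) fixed (∈-map⁺ f (arc⁺ dep xy))
      where
      fixed : f (arcName (x , y)) ≡ arcName (x , y)
      fixed with sameArc (arcName (u , v) , arcName (x , y)) in eq
      ... | false = refl
      ... | true with refl , refl ← arcName-injective {u} {v} {x} {y}
                        (sameArc-sound (arcName (u , v)) (arcName (x , y)) (subst T (sym eq) tt)) =
        contradiction (refl , refl) ne
    -- The new arc arises by swapping the entry for `(u , v)`, which is present because `uv` is an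
    -- arc of `D`.
    ... | inj₂ (refl , refl) = subst (_∈ map f G) swapped (∈-map⁺ f (arc⁺ dep uv))
      where
      swapped : f (arcName (u , v)) ≡ arcName (v , u)
      swapped with sameArc (arcName (u , v) , arcName (u , v)) | sameArc-refl (arcName (u , v))
      ... | true | _ = refl

  reversible-suc : ∀ {k} {D D′ : Digraph n} → Reversible k D D′ → Reversible (suc k) D D′
  reversible-suc done           = done
  reversible-suc (step u v a r) = step u v a (reversible-suc r)

  expand-complete : ∀ k {G Gs D D′} → G ∈ Gs → Depicts G D → Reversible k D D′ →
                    ∃[ G′ ] G′ ∈ iterate expand k Gs × Depicts G′ D′
  expand-complete zero    {G} G∈ dep done = G , G∈ , dep
  expand-complete (suc k) G∈ dep done =
    expand-complete k (∈-concatMap⁺ candidates (lose G∈ (here refl))) dep done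
  expand-complete (suc k) {G} G∈ dep (step u v a r) =
    expand-complete k
      (∈-concatMap⁺ candidates (lose G∈ (there (∈-map⁺ (λ e → reverseIn (e , G)) (arc⁺ dep a)))))
      (reverseIn-depicts dep a) r

  -- The digraph is quantified inside, after `G`: the induction hypothesis concerns the graphs left
  -- by the first round and has to be applied to the digraph already reversed there.
  expand-sound : ∀ k {Gs G′} → G′ ∈ iterate expand k Gs →
    ∃[ G ] G ∈ Gs × (∀ {D} → Depicts G D → ∃[ D′ ] Reversible k D D′ × Depicts G′ D′)
  expand-sound zero    {G′ = G} G∈ = G , G∈ , λ {D} dep → D , done , dep
  expand-sound (suc k) {Gs} G∈ with G₁ , G₁∈ , lift ← expand-sound k G∈
    with G , G∈Gs , G₁∈G ← find (∈-concatMap⁻ candidates {xs = Gs} G₁∈) with G₁∈G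
  ... | here refl = G , G∈Gs , λ dep → let D′ , r , dep′ = lift dep in D′ , reversible-suc r , dep′
  ... | there G₁∈map with e , e∈ , refl ← ∈-map⁻ (λ e → reverseIn (e , G)) G₁∈map =
    G , G∈Gs , reversed
    where
    reversed : ∀ {D} → Depicts G D → ∃[ D′ ] Reversible (suc k) D D′ × Depicts _ D′
    reversed dep with u , v , refl , a ← arc⁻ dep e∈ =
      let D′ , r , dep′ = lift (reverseIn-depicts dep a) in D′ , step u v a r , dep′

  record Names (V : List Vertex) : Set where
    field
      vertex⁻ : ∀ {x} → x ∈ V → ∃[ u ] x ≡ name u
      vertex⁺ : ∀ u → name u ∈ V

  open Names

  Captures : Digraph n → Graph → ℕ → Set
  Captures D R c = ∀ u v →
    (arcName (u , v) ∈ R → Reach D c u v) × (Reach D c u v → arcName (u , v) ∈ R)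

  module _ {V : List Vertex} (names : Names V) where

    pairs⁺ : ∀ u v → arcName (u , v) ∈ pairs V
    pairs⁺ u v = ∈-concatMap⁺ _ (lose (vertex⁺ names u) (∈-map⁺ _ (vertex⁺ names v)))

    pairs⁻ : ∀ {e} → e ∈ pairs V → ∃[ u ] ∃[ v ] e ≡ arcName (u , v)
    pairs⁻ e∈ with x , x∈ , e∈x ← find (∈-concatMap⁻ (λ u → map (λ v → u , v) V) {xs = V} e∈)
              with y , y∈ , refl ← ∈-map⁻ _ e∈x
              with u , refl ← vertex⁻ names x∈ with v , refl ← vertex⁻ names y∈ = u , v , refl

    module _ {D : Digraph n} where

      compose-captures : ∀ {R S c d} → Captures D R c → Captures D S d →
                         Captures D (compose (V , R , S)) (c + d)
      compose-captures {R} {S} {c} {d} capR capS u w = to , from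
        where
        via : Edge → Vertex → Bool
        via (u , w) v = member ((u , v) , R) ∧ member ((v , w) , S)
        to : arcName (u , w) ∈ compose (V , R , S) → Reach D (c + d) u w
        to e∈ with _ , t ← ∈-filterᵇ⁻ (λ e → any (via e) V) (pairs V) e∈
              with x , x∈ , t′ ← find (any⁻ (via (arcName (u , w))) V t)
              with v , refl ← vertex⁻ names x∈
              with r , s ← T-∧⁻ {member (arcName (u , v) , R)} t′ =
          reach-concat (proj₁ (capR u v) (member-sound _ R r)) (proj₁ (capS v w) (member-sound _ S s))
        from : Reach D (c + d) u w → arcName (u , w) ∈ compose (V , R , S)
        from r with v , r₁ , r₂ ← reach-split c r =
          ∈-filterᵇ⁺ (λ e → any (via e) V) (pairs⁺ u w)
            (any⁺ _ (lose (vertex⁺ names v)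
              (T-∧⁺ (member-complete _ (proj₂ (capR u v) r₁)) (member-complete _ (proj₂ (capS v w) r₂)))))

      diagonal-captures : Captures D (diagonal V) 0
      diagonal-captures u v = to , from
        where
        to : arcName (u , v) ∈ diagonal V → Reach D 0 u v
        to e∈ with refl ← name-injective {u} {v}
                 (sameVertex-sound (name u) (name v) (proj₂ (∈-filterᵇ⁻ sameVertex (pairs V) e∈))) = ε , z≤n
        from : Reach D 0 u v → arcName (u , v) ∈ diagonal V
        from (ε , _) = ∈-filterᵇ⁺ sameVertex (pairs⁺ u u) (sameVertex-refl (name u))

      module _ {G : Graph} (dep : Depicts G D) where

        atMostOne-captures : Captures D (atMostOne (V , G)) 1
        atMostOne-captures u v = to , from
          where
          p : Edge → Bool
          p e = sameVertex e ∨ member (e , G)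
          to : arcName (u , v) ∈ atMostOne (V , G) → Reach D 1 u v
          to e∈ with T-∨⁻ {sameVertex (arcName (u , v))} (proj₂ (∈-filterᵇ⁻ p (pairs V) e∈))
          ... | inj₁ s with refl ← name-injective {u} {v} (sameVertex-sound (name u) (name v) s) = ε , z≤n
          ... | inj₂ m with x , y , eq , a ← arc⁻ dep (member-sound _ G m)
                       with refl , refl ← arcName-injective {u} {v} {x} {y} eq = a ◅ ε , s≤s z≤n
          from : Reach D 1 u v → arcName (u , v) ∈ atMostOne (V , G)
          from (ε , _)           = ∈-filterᵇ⁺ p (pairs⁺ u u) (T-∨⁺ (inj₁ (sameVertex-refl (name u))))
          from (a ◅ ε , _)       = ∈-filterᵇ⁺ p (pairs⁺ u v)
            (T-∨⁺ {sameVertex (arcName (u , v))} (inj₂ (member-complete _ (arc⁺ dep a))))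
          from (_ ◅ _ ◅ _ , s≤s ())

        -- The bound `toℕ d + c * 2` has the form in which `fromDigits` unfolds at base 2, so the
        -- induction over the digits in `within-captures` needs no further arithmetic.
        horner-captures : ∀ d {R c} → Captures D R c →
                          Captures D (horner (isOneBit d , R , V , G)) (toℕ d + c * 2)
        horner-captures zero       {c = c} cap =
          subst (Captures D _) (double c) (compose-captures cap cap)
        horner-captures (suc zero) {c = c} cap =
          subst (Captures D _) (trans (+-comm (c + c) 1) (cong suc (double c)))
            (compose-captures (compose-captures cap cap) atMostOne-captures)

        within-captures : ∀ ds → Captures D (within (map isOneBit ds , V , G)) (fromDigits ds)
        within-captures []       = diagonal-captures
        within-captures (d ∷ ds) = horner-captures d (within-captures ds)

        withinDistance-sound : ∀ ds → T (withinDistance (G , map isOneBit ds , V)) →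
                               ∀ u v → Reach D (fromDigits ds) u v
        withinDistance-sound ds t u v = proj₁ (within-captures ds u v)
          (member-sound _ _ (lookupᵃ (all⁺ _ (pairs V) t) (pairs⁺ u v)))

        withinDistance-complete : ∀ ds → (∀ u v → Reach D (fromDigits ds) u v) →
                                  T (withinDistance (G , map isOneBit ds , V))
        withinDistance-complete ds r = all⁻ (λ e → member (e , within (map isOneBit ds , V , G)))
          (tabulateᵃ inside)
          where
          inside : ∀ {e} → e ∈ pairs V → T (member (e , within (map isOneBit ds , V , G)))
          inside e∈ with u , v , refl ← pairs⁻ e∈ =
            member-complete _ (proj₂ (within-captures ds u v) (r u v))

-- Decoding an encoded instance

blocks-bits : ∀ bs w → blocks (map bit bs ++ # ∷ w) ≡ bs ∷ blocks w
blocks-bits []       w = refl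
blocks-bits (b ∷ bs) w rewrite blocks-bits bs w = refl

blocks-rows : ∀ {n} (D : Digraph n) us →
  blocks (concatMap (λ u → tabulate (λ v → bit (D u v)) ++ # ∷ []) us) ≡ map (λ u → tabulate (D u)) us
blocks-rows D []       = refl
blocks-rows D (u ∷ us) = begin
  blocks ((tabulate (bit ∘ D u) ++ # ∷ []) ++ w)
    ≡⟨ cong blocks (++-assoc (tabulate (bit ∘ D u)) (# ∷ []) w) ⟩
  blocks (tabulate (bit ∘ D u) ++ # ∷ w)
    ≡⟨ cong (λ r → blocks (r ++ # ∷ w)) (map-tabulate (D u) bit) ⟨
  blocks (map bit (tabulate (D u)) ++ # ∷ w)
    ≡⟨ blocks-bits (tabulate (D u)) w ⟩
  tabulate (D u) ∷ blocks w
    ≡⟨ cong (tabulate (D u) ∷_) (blocks-rows D us) ⟩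
  tabulate (D u) ∷ map (λ u → tabulate (D u)) us  ∎
  where
  open ≡-Reasoning
  w = concatMap (λ u → tabulate (λ v → bit (D u v)) ++ # ∷ []) us

matrix : ∀ {n} → Digraph n → List (List Bool)
matrix D = tabulate (λ u → tabulate (D u))

module _ (I : ReversalsInstance) where
  open ReversalsInstance I

  digits : List Bit
  digits = proj₁ (toDigits 2 target)

  blocks-encodeInstance : blocks (encodeInstance I) ≡ map isOneBit digits ∷ matrix digraph
  blocks-encodeInstance = begin
    blocks (map encodeBit digits ++ # ∷ w)           ≡⟨ cong (λ r → blocks (r ++ # ∷ w)) bits ⟩
    blocks (map bit (map isOneBit digits) ++ # ∷ w)  ≡⟨ blocks-bits (map isOneBit digits) w ⟩
    map isOneBit digits ∷ blocks w                   ≡⟨ cong (map isOneBit digits ∷_) (trans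
      (blocks-rows digraph (allFin order)) (map-tabulate id (λ u → tabulate (digraph u)))) ⟩
    map isOneBit digits ∷ matrix digraph             ∎
    where
    open ≡-Reasoning
    w = concatMap (λ u → tabulate (λ v → bit (digraph u v)) ++ # ∷ []) (allFin order)
    bits : map encodeBit digits ≡ map bit (map isOneBit digits)
    bits = trans (map-cong (λ where zero → refl ; (suc _) → refl) digits) (map-∘ digits)

units : ∀ {n} {X : Set} (f : Fin n → X) → map (const tt) (tabulate f) ≡ replicate n tt
units {zero}  f = refl
units {suc n} f = cong (tt ∷_) (units (f ∘ suc))

module _ {n : ℕ} where

  -- Only the length of `tabulate g` matters: `g` stands for the rows that supply the units, `f` for
  -- the list being named, which is either the rows or the entries of one row.
  numbered⁻ : ∀ {X Y : Set} (g : Fin n → Y) (f : Fin n → X) {p} →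
              p ∈ number (map (const tt) (tabulate g) , tabulate f) → ∃[ u ] p ≡ (name u , f u)
  numbered⁻ g f p∈ rewrite units g with inj₂ eq ← number⁻ (replicate n tt) [] f p∈ = eq

  numbered⁺ : ∀ {X Y : Set} (g : Fin n → Y) (f : Fin n → X) u →
              (name u , f u) ∈ number (map (const tt) (tabulate g) , tabulate f)
  numbered⁺ g f u rewrite units g = number⁺ (replicate n tt) [] f (inj₂ (u , refl))

  module _ (D : Digraph n) where

    vertexList-names : Names (vertexList (matrix D))
    vertexList-names = record { vertex⁻ = to ; vertex⁺ = λ u → ∈-map⁺ proj₁ (numbered⁺ row row u) }
      where
      row : Fin n → List Bool
      row u = tabulate (D u)
      to : ∀ {x} → x ∈ vertexList (matrix D) → ∃[ u ] x ≡ name u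
      to x∈ with _ , p∈ , refl ← ∈-map⁻ proj₁ x∈ with u , refl ← numbered⁻ row row p∈ = u , refl

    arcList-depicts : Depicts (arcList (matrix D)) D
    arcList-depicts = record { arc⁻ = to ; arc⁺ = from }
      where
      row : Fin n → List Bool
      row u = tabulate (D u)
      arcsFrom : Vertex → Vertex × Bool → Graph
      arcsFrom u (v , b) = if b then [ (u , v) ] else []
      arcsFrom⁻ : ∀ {u v e} b → e ∈ arcsFrom u (v , b) → T b × e ≡ (u , v)
      arcsFrom⁻ true (here refl) = tt , refl
      arcsOf : Vertex × List Bool → Graph
      arcsOf (u , bs) = concatMap (arcsFrom u) (number (map (const tt) (matrix D) , bs))
      to : ∀ {e} → e ∈ arcList (matrix D) → ∃[ u ] ∃[ v ] e ≡ arcName (u , v) × Arc D u v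
      to e∈ with _ , p∈ , e∈p ← find (∈-concatMap⁻ arcsOf
                                        {xs = number (map (const tt) (matrix D) , matrix D)} e∈)
            with u , refl ← numbered⁻ row row p∈
            with _ , q∈ , e∈q ← find (∈-concatMap⁻ (arcsFrom (name u))
                                        {xs = number (map (const tt) (matrix D) , row u)} e∈p)
            with v , refl ← numbered⁻ row (D u) q∈
            with uv , refl ← arcsFrom⁻ (D u v) e∈q = u , v , refl , uv
      from : ∀ {u v} → Arc D u v → arcName (u , v) ∈ arcList (matrix D)
      from {u} {v} uv = ∈-concatMap⁺ arcsOf (lose (numbered⁺ row row u)
        (∈-concatMap⁺ (arcsFrom (name u)) (lose (numbered⁺ row (D u) v) inside)))
        where
        inside : arcName (u , v) ∈ arcsFrom (name u) (name v , D u v)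
        inside with true ← D u v = here refl

module _ (k : ℕ) (I : ReversalsInstance) where
  open ReversalsInstance I
  open DecisionProblem (k-Reversals k)

  accepts : Graph → Bool
  accepts G = withinDistance (G , map isOneBit (digits I) , vertexList (matrix digraph))

  decide-encodeInstance : decide k (encodeInstance I) ≡
                          any accepts (iterate expand k [ arcList (matrix digraph) ])
  decide-encodeInstance = cong (caseList false (decideRows k)) (blocks-encodeInstance I)

  value-digits : fromDigits (digits I) ≡ target
  value-digits = proj₂ (toDigits 2 target)

  decide-sound : T (decide k (encodeInstance I)) → Yes I
  decide-sound t
    with G′ , G′∈ , t′ ← find (any⁻ accepts _ (subst T decide-encodeInstance t))
    with G , here refl , lift ← expand-sound k G′∈
    with D′ , r , dep ← lift (arcList-depicts digraph) =
    -- A vertex exists because the diameter of the given digraph is attained.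
    D′ , r , reach⇒diameter (proj₁ (proj₁ isDiameter))
      (subst (λ d → ∀ u v → Reach D′ d u v) value-digits
        (withinDistance-sound (vertexList-names digraph) dep (digits I) t′))

  decide-complete : Yes I → T (decide k (encodeInstance I))
  decide-complete (D′ , r , m , diam , m≤)
    with G′ , G′∈ , dep ← expand-complete k (here refl) (arcList-depicts digraph) r =
    subst T (sym decide-encodeInstance) (any⁺ accepts (lose G′∈
      (withinDistance-complete (vertexList-names digraph) dep (digits I)
        (subst (λ d → ∀ u v → Reach D′ d u v) (sym value-digits) (diameter⇒reach diam m≤)))))

theorem4 : (k : ℕ) → PolynomialTime (k-Reversals k)
theorem4 k =
  computable⇒polynomialTime (k-Reversals k) (decideᶜ k) (decide-sound k) (decide-complete k)
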